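{- Let $(G,u,v)$ be a rigidly marked twice-marked bridgeless graph of genus $2$ with torsion order $k$. Then $(G,u,v)$ has $k$-general transmission if and only if the class $[u-v]\in\mathrm{Jac}(G)$ is non-recurrent.
   Context: A graph is a finite, connected, loopless multigraph (parallel edges allowed); its genus is $g=|E(G)|-|V(G)|+1$; it is bridgeless if it is 2-edge-connected. A divisor on $G$ is an element of the free abelian group on $V(G)$. Linear equivalence $\sim$ is generated by chip-firing (firing $w$ subtracts $\mathrm{val}(w)$ chips from $w$ and adds to each other vertex the number of edges joining it to $w$). $|D|$ is the set of effective divisors equivalent to $D$. The rank $r(D)$ is $-1$ if $|D|=\emptyset$, else the largest $r\ge0$ such that $|D-E|\neq\emptyset$ for every effective $E$ of degree $r$. $\mathrm{Jac}(G)$ is the group of degree-$0$ divisor classes. $\delta(P)$ is $1$ if $P$ holds and $0$ otherwise. A twice-marked graph $(G,u,v)$ is a graph with two chosen vertices; its torsion order is the least $k\ge1$ with $ku\sim kv$. A twist of $D$ is $D+au+bv$, $a,b\in\mathbb Z$. $\Delta(D)=r(D)-r(D-u)-r(D-v)+r(D-u-v)$. $D$ is submodular if $\Delta(D')\ge0$ for all twists $D'$. If $D$ is submodular, its transmission permutation $\tau^{u,v}_D$ is the unique bijection $\mathbb Z\to\mathbb Z$ with $\delta(\tau^{u,v}_D(b)=a)=\Delta(D+au-bv)$ for all $a,b$. An inversion of a bijection $\tau$ is a pair $(a,b)$ with $a<b$, $\tau(a)>\tau(b)$; two inversions $(a,b),(a',b')$ are $k$-equivalent if $a-a'=b-b'\equiv0\pmod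 k$; $\mathrm{inv}_k(\tau)$ is the number of $k$-equivalence classes of inversions. A genus-$g$ twice-marked graph has $k$-general transmission if $ku\sim kv$, every divisor is submodular, and $\mathrm{inv}_k(\tau^{u,v}_D)\le g$ for every divisor $D$. $(G,u,v)$ is rigidly marked if every divisor on $G$ is submodular and $r(u+v)=0$. A degree-$0$ class $[D]\in\mathrm{Jac}(G)$ of order $k$ is non-recurrent if for every vertex $w\in V(G)$ there is at most one integer $n\in\{1,\dots,k-1\}$ with $|nD+w|\ne\emptyset$. -}

module Defs where

open import Data.Bool.Base using (if_then_else_)
open import Data.Fin.Base using (Fin; toℕ; fromℕ<; finToFun; funToFin)
open import Data.Fin.Properties using (_≟_; any?; all?; toℕ-fromℕ<; finToFun-funToFin)
open import Data.Integer.Base using (ℤ; +_; -[1+_]; 0ℤ; 1ℤ; -1ℤ; _+_; _-_; -_; _*_; _≤_; _<_; ∣_∣; +≤+; -≤+; nonNegative)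
open import Data.Integer.Divisibility using (_∣_)
import Data.Integer.Properties as ℤ
open import Data.Integer.Tactic.RingSolver using (solve-∀)
open import Data.Nat.Base as ℕ using (ℕ; zero; suc; NonZero; z≤n; s≤s)
import Data.Nat.Properties as ℕ
open import Data.Product.Base using (Σ; ∃; ∃-syntax; _×_; _,_; proj₁; proj₂)
open import Data.Unit.Base using (⊤)
open import Function.Base using (_∘_)
open import Function.Definitions using (Bijective)
open import Relation.Binary.Construct.Closure.Equivalence as EqC using (EqClosure)
open import Relation.Binary.Construct.Closure.ReflexiveTransitive using (Star; ε; _◅_; _◅◅_)
open import Relation.Binary.Construct.Closure.Symmetric using (SymClosure; fwd; bwd)
open import Relation.Binary.PropositionalEquality
open import Relation.Binary.Structures using (IsEquivalence)
open import Relation.Nullary using (¬_; Dec; does; yes; no; contradiction)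
open import Relation.Nullary.Decidable using (map′; _⊎-dec_; _×-dec_; _→-dec_)

open import Algebra.Bundles using (CommutativeRing)
open import Algebra.Properties.Semiring.Sum (CommutativeRing.semiring ℤ.+-*-commutativeRing) public
  using (sum; sum-cong-≗; ∑-distrib-+; ∑-comm; *-distribˡ-sum; sum-replicate-zero)

δ : ∀ {p} {P : Set p} → Dec P → ℤ
δ P? = if does P? then 1ℤ else 0ℤ

IsLeastPositive : (ℕ → Set) → ℕ → Set
IsLeastPositive P k = 1 ℕ.≤ k × P k × (∀ j → 1 ℕ.≤ j → P j → k ℕ.≤ j)

-- An edge e joins src e and tgt e; the orientation is an artefact of the
-- encoding and no definition below depends on it.
Adjacent : {n m : ℕ} (src tgt : Fin m → Fin n) (Allowed : Fin m → Set) → Fin n → Fin n → Set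
Adjacent src tgt Allowed x y = ∃[ e ] (Allowed e × src e ≡ x × tgt e ≡ y)

-- Any two vertices are joined by a walk that uses allowed edges only.
ConnectedBy : {n m : ℕ} (src tgt : Fin m → Fin n) (Allowed : Fin m → Set) → Set
ConnectedBy src tgt Allowed = ∀ x y → EqClosure (Adjacent src tgt Allowed) x y

record Graph : Set where
  field
    #V #E     : ℕ
    src tgt   : Fin #E → Fin #V
    nonempty  : NonZero #V
    loopless  : ∀ e → src e ≢ tgt e
    connected : ConnectedBy src tgt (λ _ → ⊤)

module ChipFiring (G : Graph) where
  open Graph G

  Vertex : Set
  Vertex = Fin #V

  Edge : Set
  Edge = Fin #E

  genus : ℤ
  genus = + #E - + #V + 1ℤ

  Bridgeless : Set
  Bridgeless = ∀ e → ConnectedBy src tgt (_≢ e)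

  Divisor : Set
  Divisor = Vertex → ℤ

  valence : Vertex → ℤ
  valence w = sum λ e → δ ((src e ≟ w) ⊎-dec (tgt e ≟ w))

  edgesBetween : Vertex → Vertex → ℤ
  edgesBetween w x = sum λ e → δ (((src e ≟ w) ×-dec (tgt e ≟ x)) ⊎-dec ((src e ≟ x) ×-dec (tgt e ≟ w)))

  infixl 6 _+ᵈ_ _-ᵈ_
  infixl 7 _·ᵈ_

  0ᵈ : Divisor
  0ᵈ _ = 0ℤ

  _+ᵈ_ _-ᵈ_ : Divisor → Divisor → Divisor
  (D +ᵈ E) x = D x + E x
  (D -ᵈ E) x = D x - E x

  _·ᵈ_ : ℤ → Divisor → Divisor
  (a ·ᵈ D) x = a * D x

  ⟨_⟩ : Vertex → Divisor
  ⟨ w ⟩ x = δ (x ≟ w)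

  deg : Divisor → ℤ
  deg D = sum D

  Effective : Divisor → Set
  Effective D = ∀ x → 0ℤ ≤ D x

  fire : Vertex → Divisor → Divisor
  fire w D x = if does (x ≟ w) then D x - valence w else D x + edgesBetween w x

  Fires : Divisor → Divisor → Set
  Fires D D′ = ∃[ w ] D′ ≗ fire w D

  infix 4 _∼_
  _∼_ : Divisor → Divisor → Set
  _∼_ = EqClosure Fires

  infix 4 _∈∣_∣
  _∈∣_∣ : Divisor → Divisor → Set
  E ∈∣ D ∣ = Effective E × D ∼ E

  NonEmpty∣_∣ : Divisor → Set
  NonEmpty∣ D ∣ = ∃[ E ] E ∈∣ D ∣

  RankAtLeast : Divisor → ℕ → Set
  RankAtLeast D r = ∀ E → Effective E → deg E ≡ + r → NonEmpty∣ D -ᵈ E ∣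

  data IsRank (D : Divisor) : ℤ → Set where
    rank-empty    : ¬ NonEmpty∣ D ∣ → IsRank D -1ℤ
    rank-nonempty : ∀ r → NonEmpty∣ D ∣ → RankAtLeast D r →
                    (∀ s → RankAtLeast D s → s ℕ.≤ r) → IsRank D (+ r)

  IsRank-unique : ∀ {D r s} → IsRank D r → IsRank D s → r ≡ s
  IsRank-unique (rank-empty _)    (rank-empty _)            = refl
  IsRank-unique (rank-empty ¬p)   (rank-nonempty _ p _ _)   = contradiction p ¬p
  IsRank-unique (rank-nonempty _ p _ _) (rank-empty ¬p)     = contradiction p ¬p
  IsRank-unique (rank-nonempty r _ p q) (rank-nonempty s _ p′ q′) =
    cong +_ (ℕ.≤-antisym (q′ r p) (q s p′))

  -- Existence of the rank.  D ∼ D′ holds iff D′ = D - laplacian f for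
  -- some firing script f.  If D - laplacian f is effective, then f varies
  -- along each edge by at most Σ ∣D∣, so, after normalising f to vanish
  -- at a base vertex, only finitely many scripts need to be searched.

  boundary : Edge → Divisor
  boundary e x = δ (src e ≟ x) - δ (tgt e ≟ x)

  laplacian : (Vertex → ℤ) → Divisor
  laplacian f x = sum λ e → (f (src e) - f (tgt e)) * boundary e x

  private
    sum-neg : ∀ {n} (f : Fin n → ℤ) → sum (λ i → - f i) ≡ - sum f
    sum-neg {zero}  f = refl
    sum-neg {suc n} f = trans (cong (λ z → - f Fin.zero + z) (sum-neg (f ∘ Fin.suc)))
                              (sym (ℤ.neg-distrib-+ (f Fin.zero) _))

    sum-mono : ∀ {n} {f g : Fin n → ℤ} → (∀ i → f i ≤ g i) → sum f ≤ sum g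
    sum-mono {zero}  p = ℤ.≤-refl
    sum-mono {suc n} p = ℤ.+-mono-≤ (p Fin.zero) (sum-mono (p ∘ Fin.suc))

    sum-nonneg : ∀ {n} {f : Fin n → ℤ} → (∀ i → 0ℤ ≤ f i) → 0ℤ ≤ sum f
    sum-nonneg {n} p = ℤ.≤-trans (ℤ.≤-reflexive (sym (sum-replicate-zero n))) (sum-mono p)

    term≤sum : ∀ {n} {f : Fin n → ℤ} → (∀ i → 0ℤ ≤ f i) → ∀ i → f i ≤ sum f
    term≤sum {f = f} p Fin.zero    = ℤ.≤-trans (ℤ.≤-reflexive (sym (ℤ.+-identityʳ _)))
                                         (ℤ.+-monoʳ-≤ (f Fin.zero) (sum-nonneg (p ∘ Fin.suc)))
    term≤sum {f = f} p (Fin.suc i) = ℤ.≤-trans (term≤sum (p ∘ Fin.suc) i)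
                                       (ℤ.≤-trans (ℤ.≤-reflexive (sym (ℤ.+-identityˡ _)))
                                         (ℤ.+-monoˡ-≤ _ (p Fin.zero)))

    δ-suc : ∀ {n} (i j : Fin n) → δ (Fin.suc i ≟ Fin.suc j) ≡ δ (i ≟ j)
    δ-suc i j with i ≟ j
    ... | yes _ = refl
    ... | no  _ = refl

    sum-δˡ : ∀ {n} (g : Fin n → ℤ) (a : Fin n) → sum (λ x → g x * δ (a ≟ x)) ≡ g a
    sum-δˡ {suc n} g Fin.zero = begin
      g Fin.zero * 1ℤ + sum (λ x → g (Fin.suc x) * 0ℤ)
        ≡⟨ cong₂ _+_ (ℤ.*-identityʳ (g Fin.zero)) (trans (sum-cong-≗ (λ x → ℤ.*-zeroʳ (g (Fin.suc x)))) (sum-replicate-zero n)) ⟩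
      g Fin.zero + 0ℤ
        ≡⟨ ℤ.+-identityʳ _ ⟩
      g Fin.zero ∎
      where open ≡-Reasoning
    sum-δˡ {suc n} g (Fin.suc a) = begin
      g Fin.zero * 0ℤ + sum (λ x → g (Fin.suc x) * δ (Fin.suc a ≟ Fin.suc x))
        ≡⟨ cong₂ _+_ (ℤ.*-zeroʳ (g Fin.zero)) (sum-cong-≗ (λ x → cong (g (Fin.suc x) *_) (δ-suc a x))) ⟩
      0ℤ + sum (λ x → g (Fin.suc x) * δ (a ≟ x))
        ≡⟨ ℤ.+-identityˡ _ ⟩
      sum (λ x → g (Fin.suc x) * δ (a ≟ x))
        ≡⟨ sum-δˡ (g ∘ Fin.suc) a ⟩
      g (Fin.suc a) ∎
      where open ≡-Reasoning

    δ-sym : ∀ {n} (i j : Fin n) → δ (i ≟ j) ≡ δ (j ≟ i)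
    δ-sym i j with i ≟ j | j ≟ i
    ... | yes _ | yes _ = refl
    ... | no _  | no _  = refl
    ... | yes p | no q  = contradiction (sym p) q
    ... | no p  | yes q = contradiction (sym q) p

    valence-term : ∀ {n} (a b w : Fin n) → a ≢ b →
      (δ (a ≟ w) - δ (b ≟ w)) * (δ (a ≟ w) - δ (b ≟ w)) ≡ δ ((a ≟ w) ⊎-dec (b ≟ w))
    valence-term a b w a≢b with a ≟ w | b ≟ w
    ... | yes p | yes q = contradiction (trans p (sym q)) a≢b
    ... | yes _ | no _  = refl
    ... | no _  | yes _ = refl
    ... | no _  | no _  = refl

    between-term : ∀ {n} (a b w x : Fin n) → a ≢ b → x ≢ w →
      (δ (a ≟ w) - δ (b ≟ w)) * (δ (a ≟ x) - δ (b ≟ x))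
        ≡ - δ (((a ≟ w) ×-dec (b ≟ x)) ⊎-dec ((a ≟ x) ×-dec (b ≟ w)))
    between-term a b w x a≢b x≢w with a ≟ w | b ≟ w | a ≟ x | b ≟ x
    ... | yes p | yes q | _     | _     = contradiction (trans p (sym q)) a≢b
    ... | yes p | _     | yes q | _     = contradiction (trans (sym q) p) x≢w
    ... | _     | yes p | _     | yes q = contradiction (trans (sym q) p) x≢w
    ... | _     | _     | yes p | yes q = contradiction (trans p (sym q)) a≢b
    ... | yes _ | no _  | no _  | yes _ = refl
    ... | yes _ | no _  | no _  | no _  = refl
    ... | no _  | yes _ | yes _ | no _  = refl
    ... | no _  | yes _ | no _  | no _  = refl
    ... | no _  | no _  | yes _ | no _  = refl
    ... | no _  | no _  | no _  | yes _ = refl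
    ... | no _  | no _  | no _  | no _  = refl

  fire-laplacian : ∀ w D → fire w D ≗ D -ᵈ laplacian ⟨ w ⟩
  fire-laplacian w D x with x ≟ w
  ... | yes refl = cong (λ z → D x - z)
                     (sym (sum-cong-≗ (λ e → valence-term (src e) (tgt e) w (loopless e))))
  ... | no x≢w   = cong (λ z → D x + z) (begin
    edgesBetween w x
      ≡⟨ sym (ℤ.neg-involutive _) ⟩
    - - edgesBetween w x
      ≡⟨ cong -_ (sym (sum-neg (λ e → δ (((src e ≟ w) ×-dec (tgt e ≟ x)) ⊎-dec ((src e ≟ x) ×-dec (tgt e ≟ w)))))) ⟩
    - sum (λ e → - δ (((src e ≟ w) ×-dec (tgt e ≟ x)) ⊎-dec ((src e ≟ x) ×-dec (tgt e ≟ w))))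
      ≡⟨ cong -_ (sym (sum-cong-≗ (λ e → between-term (src e) (tgt e) w x (loopless e) x≢w))) ⟩
    - laplacian ⟨ w ⟩ x ∎)
    where open ≡-Reasoning

  private
    laplacian-cong : ∀ {f g} → f ≗ g → laplacian f ≗ laplacian g
    laplacian-cong p x = sum-cong-≗ (λ e → cong₂ (λ a b → (a - b) * boundary e x) (p (src e)) (p (tgt e)))

    laplacian-0 : ∀ x → laplacian (λ _ → 0ℤ) x ≡ 0ℤ
    laplacian-0 x = trans (sum-cong-≗ (λ e → ℤ.*-zeroˡ (boundary e x))) (sum-replicate-zero #E)

    laplacian-+ : ∀ f g x → laplacian (λ y → f y + g y) x ≡ laplacian f x + laplacian g x
    laplacian-+ f g x = trans
      (sum-cong-≗ (λ e → lemma (f (src e)) (g (src e)) (f (tgt e)) (g (tgt e)) (boundary e x)))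
      (∑-distrib-+ (λ e → (f (src e) - f (tgt e)) * boundary e x) (λ e → (g (src e) - g (tgt e)) * boundary e x))
      where
      lemma : ∀ a b c d z → (a + b - (c + d)) * z ≡ (a - c) * z + (b - d) * z
      lemma = solve-∀

    laplacian-neg : ∀ f x → laplacian (λ y → - f y) x ≡ - laplacian f x
    laplacian-neg f x = trans
      (sum-cong-≗ (λ e → lemma (f (src e)) (f (tgt e)) (boundary e x)))
      (sum-neg (λ e → (f (src e) - f (tgt e)) * boundary e x))
      where
      lemma : ∀ a b z → (- a - - b) * z ≡ - ((a - b) * z)
      lemma = solve-∀

    laplacian-shift : ∀ f c x → laplacian (λ y → f y - c) x ≡ laplacian f x
    laplacian-shift f c x = sum-cong-≗ (λ e → lemma (f (src e)) (f (tgt e)) c (boundary e x))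
      where
      lemma : ∀ a b c z → (a - c - (b - c)) * z ≡ (a - b) * z
      lemma = solve-∀

    pairing : ∀ (f g : Vertex → ℤ) →
      sum (λ x → g x * laplacian f x) ≡ sum (λ e → (f (src e) - f (tgt e)) * (g (src e) - g (tgt e)))
    pairing f g = begin
      sum (λ x → g x * laplacian f x)
        ≡⟨ sum-cong-≗ (λ x → *-distribˡ-sum (g x) (λ e → d e * boundary e x)) ⟩
      sum (λ x → sum (λ e → g x * (d e * boundary e x)))
        ≡⟨ ∑-comm (λ x e → g x * (d e * boundary e x)) ⟩
      sum (λ e → sum (λ x → g x * (d e * boundary e x)))
        ≡⟨ sum-cong-≗ edge ⟩
      sum (λ e → d e * (g (src e) - g (tgt e))) ∎
      where
      open ≡-Reasoning
      d : Edge → ℤ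
      d e = f (src e) - f (tgt e)
      rearr : ∀ g d a b → g * (d * (a - b)) ≡ d * (g * a + - (g * b))
      rearr = solve-∀
      edge : ∀ e → sum (λ x → g x * (d e * boundary e x)) ≡ d e * (g (src e) - g (tgt e))
      edge e = begin
        sum (λ x → g x * (d e * boundary e x))
          ≡⟨ sum-cong-≗ (λ x → rearr (g x) (d e) (δ (src e ≟ x)) (δ (tgt e ≟ x))) ⟩
        sum (λ x → d e * (g x * δ (src e ≟ x) + - (g x * δ (tgt e ≟ x))))
          ≡⟨ sym (*-distribˡ-sum (d e) (λ x → g x * δ (src e ≟ x) + - (g x * δ (tgt e ≟ x)))) ⟩
        d e * sum (λ x → g x * δ (src e ≟ x) + - (g x * δ (tgt e ≟ x)))
          ≡⟨ cong (d e *_) (∑-distrib-+ (λ x → g x * δ (src e ≟ x)) (λ x → - (g x * δ (tgt e ≟ x)))) ⟩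
        d e * (sum (λ x → g x * δ (src e ≟ x)) + sum (λ x → - (g x * δ (tgt e ≟ x))))
          ≡⟨ cong (d e *_) (cong₂ _+_ (sum-δˡ g (src e))
               (trans (sum-neg (λ x → g x * δ (tgt e ≟ x))) (cong -_ (sum-δˡ g (tgt e))))) ⟩
        d e * (g (src e) - g (tgt e)) ∎

  ScriptEquivalent : Divisor → Divisor → Set
  ScriptEquivalent D D′ = ∃[ f ] D′ ≗ D -ᵈ laplacian f

  private
    script-isEquivalence : IsEquivalence ScriptEquivalent
    script-isEquivalence = record
      { refl  = λ {D} → (λ _ → 0ℤ) , λ x → sym (trans (cong (λ z → D x - z) (laplacian-0 x)) (ℤ.+-identityʳ (D x)))
      ; sym   = λ { {D} {D′} (f , p) → (λ y → - f y) , λ x →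
                  trans (lemma₁ (D x) (laplacian f x))
                    (cong₂ _-_ (sym (p x)) (sym (laplacian-neg f x))) }
      ; trans = λ { {D} (f , p) (g , q) → (λ y → f y + g y) , λ x →
                  trans (q x) (trans (cong (_- laplacian g x) (p x))
                    (trans (lemma₂ (D x) (laplacian f x) (laplacian g x))
                      (cong (λ z → D x - z) (sym (laplacian-+ f g x))))) }
      }
      where
      lemma₁ : ∀ a b → a ≡ (a - b) - (- b)
      lemma₁ = solve-∀
      lemma₂ : ∀ a b c → a - b - c ≡ a - (b + c)
      lemma₂ = solve-∀

  ∼⇒script : ∀ {D D′} → D ∼ D′ → ScriptEquivalent D D′
  ∼⇒script = EqC.fold script-isEquivalence
    (λ { {D} (w , p) → ⟨ w ⟩ , λ x → trans (p x) (fire-laplacian w D x) })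

  baseVertex : Vertex
  baseVertex = lemma #V nonempty
    where
    lemma : ∀ n → NonZero n → Fin n
    lemma (suc n) _ = Fin.zero

  ≗⇒∼ : ∀ {D D′} → D ≗ D′ → D ∼ D′
  ≗⇒∼ {D} {D′} p = fwd (baseVertex , λ _ → refl) ◅ bwd (baseVertex , fire-cong) ◅ ε
    where
    fire-cong : fire baseVertex D ≗ fire baseVertex D′
    fire-cong x with x ≟ baseVertex
    ... | yes _ = cong (_- _) (p x)
    ... | no _  = cong (_+ _) (p x)

  ∼-sym : ∀ {D D′} → D ∼ D′ → D′ ∼ D
  ∼-sym = EqC.symmetric Fires

  private
    Realisable : (Vertex → ℤ) → Set
    Realisable f = ∀ D → D ∼ D -ᵈ laplacian f

    real-cong : ∀ {f g} → f ≗ g → Realisable f → Realisable g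
    real-cong p r D = r D ◅◅ ≗⇒∼ (λ x → cong (λ z → D x - z) (laplacian-cong p x))

    real-0 : Realisable (λ _ → 0ℤ)
    real-0 D = ≗⇒∼ (λ x → sym (trans (cong (λ z → D x - z) (laplacian-0 x)) (ℤ.+-identityʳ (D x))))

    real-+ : ∀ {f g} → Realisable f → Realisable g → Realisable (λ x → f x + g x)
    real-+ {f} {g} r s D = r D ◅◅ s (D -ᵈ laplacian f) ◅◅ ≗⇒∼ (λ x →
      trans (lemma (D x) (laplacian f x) (laplacian g x)) (cong (λ z → D x - z) (sym (laplacian-+ f g x))))
      where
      lemma : ∀ a b c → a - b - c ≡ a - (b + c)
      lemma = solve-∀

    real-neg : ∀ {f} → Realisable f → Realisable (λ x → - f x)
    real-neg {f} r D = ≗⇒∼ (λ x → trans (lemma (D x) (laplacian f x))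
        (cong (λ z → D x - z - laplacian f x) (sym (laplacian-neg f x))))
      ◅◅ ∼-sym (r (D -ᵈ laplacian (λ x → - f x)))
      where
      lemma : ∀ a b → a ≡ a - (- b) - b
      lemma = solve-∀

    real-ℕ : ∀ n {f} → Realisable f → Realisable (λ x → + n * f x)
    real-ℕ zero    r = real-0
    real-ℕ (suc n) {f} r = real-cong (λ x → lemma (+ n) (f x)) (real-+ {f} {λ x → + n * f x} r (real-ℕ n {f} r))
      where
      lemma : ∀ n z → z + n * z ≡ (+ 1 + n) * z
      lemma = solve-∀

    real-ℤ : ∀ c {f} → Realisable f → Realisable (λ x → c * f x)
    real-ℤ (+ n)      {f} r = real-ℕ n {f} r
    real-ℤ (-[1+ n ]) {f} r = real-cong (λ x → ℤ.neg-distribˡ-* (+ suc n) (f x)) (real-neg {λ x → + suc n * f x} (real-ℕ (suc n) {f} r))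

    real-sum : ∀ n (F : Fin n → Vertex → ℤ) → (∀ i → Realisable (F i)) → Realisable (λ x → sum (λ i → F i x))
    real-sum zero    F r = real-0
    real-sum (suc n) F r = real-+ {F Fin.zero} {λ x → sum (λ i → F (Fin.suc i) x)} (r Fin.zero) (real-sum n (F ∘ Fin.suc) (r ∘ Fin.suc))

    real-all : ∀ f → Realisable f
    real-all f = real-cong (λ x → sum-δˡ f x)
      (real-sum #V (λ w x → f w * ⟨ w ⟩ x) (λ w → real-ℤ (f w) {⟨ w ⟩} (real-⟨⟩ w)))
      where
      real-⟨⟩ : ∀ w → Realisable ⟨ w ⟩
      real-⟨⟩ w D = EqC.return (w , λ x → sym (fire-laplacian w D x))

  script⇒∼ : ∀ {D D′} → ScriptEquivalent D D′ → D ∼ D′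
  script⇒∼ {D} (f , p) = real-all f D ◅◅ ≗⇒∼ (λ x → sym (p x))

  deg-∼ : ∀ {D D′} → D ∼ D′ → deg D ≡ deg D′
  deg-∼ {D} {D′} D∼D′ with ∼⇒script D∼D′
  ... | f , p = sym (begin
    sum D′
      ≡⟨ sum-cong-≗ p ⟩
    sum (λ x → D x + - laplacian f x)
      ≡⟨ ∑-distrib-+ D (λ x → - laplacian f x) ⟩
    sum D + sum (λ x → - laplacian f x)
      ≡⟨ cong (λ z → sum D + z) (trans (sum-neg (laplacian f)) (cong -_ total)) ⟩
    sum D + 0ℤ
      ≡⟨ ℤ.+-identityʳ _ ⟩
    sum D ∎)
    where
    open ≡-Reasoning
    total : sum (laplacian f) ≡ 0ℤ
    total = begin
      sum (laplacian f)
        ≡⟨ sum-cong-≗ (λ x → sym (ℤ.*-identityˡ (laplacian f x))) ⟩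
      sum (λ x → 1ℤ * laplacian f x)
        ≡⟨ pairing f (λ _ → 1ℤ) ⟩
      sum (λ e → (f (src e) - f (tgt e)) * 0ℤ)
        ≡⟨ sum-cong-≗ (λ e → ℤ.*-zeroʳ (f (src e) - f (tgt e))) ⟩
      sum {#E} (λ _ → 0ℤ)
        ≡⟨ sum-replicate-zero #E ⟩
      0ℤ ∎

  deg-+ : ∀ D E → deg (D +ᵈ E) ≡ deg D + deg E
  deg-+ = ∑-distrib-+

  deg-- : ∀ D E → deg (D -ᵈ E) ≡ deg D - deg E
  deg-- D E = trans (∑-distrib-+ D (λ x → - E x)) (cong (λ z → deg D + z) (sum-neg E))

  deg-· : ∀ a D → deg (a ·ᵈ D) ≡ a * deg D
  deg-· a D = sym (*-distribˡ-sum a D)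

  deg-⟨⟩ : ∀ w → deg ⟨ w ⟩ ≡ 1ℤ
  deg-⟨⟩ w = trans (sum-cong-≗ (λ x → trans (δ-sym x w) (sym (ℤ.*-identityˡ (δ (w ≟ x))))))
                   (sum-δˡ (λ _ → 1ℤ) w)

  nonEmpty-resp-≗ : ∀ {D D′} → D ≗ D′ → NonEmpty∣ D ∣ → NonEmpty∣ D′ ∣
  nonEmpty-resp-≗ p (E , eff , D∼E) = E , eff , ≗⇒∼ (λ x → sym (p x)) ◅◅ D∼E

  private
    ≤-shuffle : ∀ {a b c} → a - b ≤ c → a ≤ b + c
    ≤-shuffle {a} {b} {c} p = subst (_≤ b + c) (lemma a b) (ℤ.+-monoʳ-≤ b p)
      where
      lemma : ∀ a b → b + (a - b) ≡ a
      lemma = solve-∀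

    i≤∣i∣ : ∀ i → i ≤ + ∣ i ∣
    i≤∣i∣ (+ n)      = ℤ.≤-refl
    i≤∣i∣ (-[1+ n ]) = -≤+

    totalAbs : Divisor → ℤ
    totalAbs D = sum (λ x → + ∣ D x ∣)

    0≤totalAbs : ∀ D → 0ℤ ≤ totalAbs D
    0≤totalAbs D = sum-nonneg {f = λ x → + ∣ D x ∣} (λ x → +≤+ z≤n)

    module Bound (D : Divisor) (f : Vertex → ℤ) (eff : Effective (D -ᵈ laplacian f)) where

      step-mono : ∀ c a b → 0ℤ ≤ (a - b) * (δ (c ℤ.≤? a) - δ (c ℤ.≤? b))
      step-mono c a b with c ℤ.≤? a | c ℤ.≤? b
      ... | yes _ | yes _ = ℤ.≤-reflexive (sym (ℤ.*-zeroʳ (a - b)))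
      ... | no _  | no _  = ℤ.≤-reflexive (sym (ℤ.*-zeroʳ (a - b)))
      ... | yes p | no q  = ℤ.≤-trans (ℤ.i≤j⇒0≤j-i (ℤ.≤-trans (ℤ.<⇒≤ (ℤ.≰⇒> q)) p))
                                      (ℤ.≤-reflexive (lemma (a - b)))
        where
        lemma : ∀ z → z ≡ z * (1ℤ - 0ℤ)
        lemma = solve-∀
      ... | no p  | yes q = ℤ.≤-trans (ℤ.i≤j⇒0≤j-i (ℤ.≤-trans (ℤ.<⇒≤ (ℤ.≰⇒> p)) q))
                                      (ℤ.≤-reflexive (lemma a b))
        where
        lemma : ∀ a b → b - a ≡ (a - b) * (0ℤ - 1ℤ)
        lemma = solve-∀

      flow : ∀ c e → (f (src e) - f (tgt e)) * (δ (c ℤ.≤? f (src e)) - δ (c ℤ.≤? f (tgt e))) ≤ totalAbs D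
      flow c e = ℤ.≤-trans
        (term≤sum (λ e → step-mono c (f (src e)) (f (tgt e))) e)
        (ℤ.≤-trans (ℤ.≤-reflexive (sym (pairing f (λ x → δ (c ℤ.≤? f x)))))
          (sum-mono cut))
        where
        cut : ∀ x → δ (c ℤ.≤? f x) * laplacian f x ≤ + ∣ D x ∣
        cut x with c ℤ.≤? f x
        ... | yes _ = ℤ.≤-trans (ℤ.≤-reflexive (ℤ.*-identityˡ (laplacian f x)))
                        (ℤ.≤-trans (ℤ.0≤i-j⇒j≤i (eff x)) (i≤∣i∣ (D x)))
        ... | no _  = ℤ.≤-trans (ℤ.≤-reflexive (ℤ.*-zeroˡ (laplacian f x))) (+≤+ z≤n)

      src-gap : ∀ e → f (src e) - f (tgt e) ≤ totalAbs D
      src-gap e with f (src e) ℤ.≤? f (tgt e)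
      ... | yes p = ℤ.≤-trans (ℤ.i≤j⇒i-j≤0 p) (0≤totalAbs D)
      ... | no p with flow (f (src e)) e
      ...   | q with f (src e) ℤ.≤? f (src e) | f (src e) ℤ.≤? f (tgt e)
      ...     | no r  | _     = contradiction ℤ.≤-refl r
      ...     | yes _ | yes r = contradiction r p
      ...     | yes _ | no _  = ℤ.≤-trans (ℤ.≤-reflexive (lemma (f (src e) - f (tgt e)))) q
        where
        lemma : ∀ z → z ≡ z * (1ℤ - 0ℤ)
        lemma = solve-∀

      tgt-gap : ∀ e → f (tgt e) - f (src e) ≤ totalAbs D
      tgt-gap e with f (tgt e) ℤ.≤? f (src e)
      ... | yes p = ℤ.≤-trans (ℤ.i≤j⇒i-j≤0 p) (0≤totalAbs D)
      ... | no p with flow (f (tgt e)) e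
      ...   | q with f (tgt e) ℤ.≤? f (tgt e) | f (tgt e) ℤ.≤? f (src e)
      ...     | no r  | _     = contradiction ℤ.≤-refl r
      ...     | yes _ | yes r = contradiction r p
      ...     | yes _ | no _  = ℤ.≤-trans (ℤ.≤-reflexive (lemma (f (src e)) (f (tgt e)))) q
        where
        lemma : ∀ a b → b - a ≡ (a - b) * (0ℤ - 1ℤ)
        lemma = solve-∀

    Walk : Vertex → Vertex → Set
    Walk = EqClosure (Adjacent src tgt (λ _ → ⊤))

    len : ∀ {x y} → Walk x y → ℕ
    len ε       = 0
    len (_ ◅ w) = suc (len w)

    walk-bound : ∀ D f → Effective (D -ᵈ laplacian f) → ∀ {x y} (w : Walk x y) →
      (f x ≤ f y + + len w * totalAbs D) × (f y ≤ f x + + len w * totalAbs D)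
    walk-bound D f eff {x} ε = ℤ.≤-reflexive (lemma (f x) (totalAbs D)) , ℤ.≤-reflexive (lemma (f x) (totalAbs D))
      where
      lemma : ∀ a c → a ≡ a + 0ℤ * c
      lemma = solve-∀
    walk-bound D f eff {x} {z} (_◅_ {j = y} s w) = fwd-bound , bwd-bound
      where
      C = totalAbs D
      open Bound D f eff
      gaps : SymClosure (Adjacent src tgt (λ _ → ⊤)) x y → (f x - f y ≤ C) × (f y - f x ≤ C)
      gaps (fwd (e , _ , refl , refl)) = src-gap e , tgt-gap e
      gaps (bwd (e , _ , refl , refl)) = tgt-gap e , src-gap e
      lemma₁ : ∀ a l c → (a + l * c) + c ≡ a + (+ 1 + l) * c
      lemma₁ = solve-∀
      fwd-bound : f x ≤ f z + + suc (len w) * C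
      fwd-bound = ℤ.≤-trans (≤-shuffle {f x} {f y} (proj₁ (gaps s)))
        (ℤ.≤-trans (ℤ.+-monoˡ-≤ C (proj₁ (walk-bound D f eff w)))
          (ℤ.≤-reflexive (lemma₁ (f z) (+ len w) C)))
      lemma₂ : ∀ a l c → (a + c) + l * c ≡ a + (+ 1 + l) * c
      lemma₂ = solve-∀
      bwd-bound : f z ≤ f x + + suc (len w) * C
      bwd-bound = ℤ.≤-trans (proj₂ (walk-bound D f eff w))
        (ℤ.≤-trans (ℤ.+-monoˡ-≤ (+ len w * C) (≤-shuffle {f y} {f x} (proj₂ (gaps s))))
          (ℤ.≤-reflexive (lemma₂ (f x) (+ len w) C)))

    diameter : ℤ
    diameter = sum (λ x → + len (connected baseVertex x))

    bound : Divisor → ℕ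
    bound D = ∣ diameter * totalAbs D ∣

    len*≤bound : ∀ D x → + len (connected baseVertex x) * totalAbs D ≤ + bound D
    len*≤bound D x = ℤ.≤-trans
      (ℤ.*-monoʳ-≤-nonNeg (totalAbs D) {{nonNegative (0≤totalAbs D)}}
        (term≤sum {f = λ x → + len (connected baseVertex x)} (λ x → +≤+ z≤n) x))
      (i≤∣i∣ _)

    candidate : ∀ B → Fin (suc (B ℕ.+ B) ℕ.^ #V) → Vertex → ℤ
    candidate B i x = + toℕ (finToFun {suc (B ℕ.+ B)} {#V} i x) - + B

    encode : ∀ B (f : Vertex → ℤ) → (∀ x → - + B ≤ f x) → (∀ x → f x ≤ + B) → ∃[ i ] candidate B i ≗ f
    encode B f lo hi = funToFin h , λ x → trans (cong (λ z → + toℕ z - + B) (finToFun-funToFin h x)) (eq x)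
      where
      0≤f+B : ∀ x → 0ℤ ≤ f x + + B
      0≤f+B x = ℤ.≤-trans (ℤ.≤-reflexive (sym (ℤ.+-inverseˡ (+ B)))) (ℤ.+-monoˡ-≤ (+ B) (lo x))
      abs-eq : ∀ x → + ∣ f x + + B ∣ ≡ f x + + B
      abs-eq x = ℤ.0≤i⇒+∣i∣≡i (0≤f+B x)
      small : ∀ x → ∣ f x + + B ∣ ℕ.< suc (B ℕ.+ B)
      small x = s≤s (ℤ.drop‿+≤+ (subst (_≤ + (B ℕ.+ B)) (sym (abs-eq x)) (ℤ.+-monoˡ-≤ (+ B) (hi x))))
      h : Vertex → Fin (suc (B ℕ.+ B))
      h x = fromℕ< (small x)
      lemma : ∀ a b → a + b - b ≡ a
      lemma = solve-∀
      eq : ∀ x → + toℕ (h x) - + B ≡ f x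
      eq x = trans (cong (λ z → + z - + B) (toℕ-fromℕ< (small x)))
               (trans (cong (_- + B) (abs-eq x)) (lemma (f x) (+ B)))

    search-complete : ∀ D → NonEmpty∣ D ∣ → ∃[ i ] Effective (D -ᵈ laplacian (candidate (bound D) i))
    search-complete D (E , effE , D∼E) with ∼⇒script D∼E
    ... | f , p = proj₁ enc , λ x → subst (0ℤ ≤_) (cong (λ z → D x - z)
                    (trans (sym (laplacian-shift f (f baseVertex) x)) (sym (laplacian-cong (proj₂ enc) x)))) (eff x)
      where
      eff : Effective (D -ᵈ laplacian f)
      eff x = subst (0ℤ ≤_) (p x) (effE x)
      walk : ∀ x → _
      walk x = walk-bound D f eff (connected baseVertex x)
      lo : ∀ x → - + bound D ≤ f x - f baseVertex
      lo x = ℤ.≤-trans (ℤ.neg-mono-≤ (ℤ.≤-trans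
               (ℤ.≤-trans (ℤ.+-monoˡ-≤ (- f x) (proj₁ (walk x))) (ℤ.≤-reflexive (lemma₁ (f x) _)))
               (len*≤bound D x))) (ℤ.≤-reflexive (lemma₂ (f baseVertex) (f x)))
        where
        lemma₁ : ∀ a b → a + b - a ≡ b
        lemma₁ = solve-∀
        lemma₂ : ∀ a b → - (a - b) ≡ b - a
        lemma₂ = solve-∀
      hi : ∀ x → f x - f baseVertex ≤ + bound D
      hi x = ℤ.≤-trans
               (ℤ.≤-trans (ℤ.+-monoˡ-≤ (- f baseVertex) (proj₂ (walk x))) (ℤ.≤-reflexive (lemma₁ (f baseVertex) _)))
               (len*≤bound D x)
        where
        lemma₁ : ∀ a b → a + b - a ≡ b
        lemma₁ = solve-∀
      enc = encode (bound D) (λ x → f x - f baseVertex) lo hi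

  abstract
    nonEmpty? : ∀ D → Dec NonEmpty∣ D ∣
    nonEmpty? D = map′
      (λ { (i , eff) → _ , eff , script⇒∼ (candidate (bound D) i , λ _ → refl) })
      (search-complete D)
      (any? (λ i → all? (λ x → 0ℤ ℤ.≤? D x - laplacian (candidate (bound D) i) x)))

    rankAtLeast? : ∀ D r → Dec (RankAtLeast D r)
    rankAtLeast? D r = map′ to from
      (all? (λ i → (sum (F i) ℤ.≟ + r) →-dec nonEmpty? (D -ᵈ F i)))
      where
      F : Fin (suc r ℕ.^ #V) → Divisor
      F i x = + toℕ (finToFun {suc r} {#V} i x)
      from : RankAtLeast D r → ∀ i → sum (F i) ≡ + r → NonEmpty∣ D -ᵈ F i ∣
      from p i q = p (F i) (λ x → +≤+ z≤n) q
      to : (∀ i → sum (F i) ≡ + r → NonEmpty∣ D -ᵈ F i ∣) → RankAtLeast D r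
      to p E eff q = nonEmpty-resp-≗ (λ x → cong (λ z → D x - z) (eq x))
                       (p (funToFin h) (trans (sum-cong-≗ eq) q))
        where
        abs-eq : ∀ x → + ∣ E x ∣ ≡ E x
        abs-eq x = ℤ.0≤i⇒+∣i∣≡i (eff x)
        small : ∀ x → ∣ E x ∣ ℕ.< suc r
        small x = s≤s (ℤ.drop‿+≤+ (subst₂ _≤_ (sym (abs-eq x)) q (term≤sum eff x)))
        h : Vertex → Fin (suc r)
        h x = fromℕ< (small x)
        eq : ∀ x → F (funToFin h) x ≡ E x
        eq x = trans (cong (λ z → + toℕ z) (finToFun-funToFin h x))
                 (trans (cong +_ (toℕ-fromℕ< (small x))) (abs-eq x))

  private
    rankAtLeast-0 : ∀ D → NonEmpty∣ D ∣ → RankAtLeast D 0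
    rankAtLeast-0 D ne E eff q = nonEmpty-resp-≗ (λ x → sym (trans (cong (λ z → D x - z) (zeroE x)) (ℤ.+-identityʳ (D x)))) ne
      where
      zeroE : ∀ x → E x ≡ 0ℤ
      zeroE x = ℤ.≤-antisym (subst (E x ≤_) q (term≤sum eff x)) (eff x)

    rankAtLeast-bound : ∀ D s → RankAtLeast D s → s ℕ.≤ ∣ deg D ∣
    rankAtLeast-bound D s p = ℤ.drop‿+≤+ (ℤ.≤-trans s≤deg (i≤∣i∣ (deg D)))
      where
      E : Divisor
      E = + s ·ᵈ ⟨ baseVertex ⟩
      effE : Effective E
      effE x with x ≟ baseVertex
      ... | yes _ = ℤ.≤-trans (+≤+ z≤n) (ℤ.≤-reflexive (sym (ℤ.*-identityʳ (+ s))))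
      ... | no _  = ℤ.≤-reflexive (sym (ℤ.*-zeroʳ (+ s)))
      degE : deg E ≡ + s
      degE = trans (deg-· (+ s) ⟨ baseVertex ⟩) (trans (cong (+ s *_) (deg-⟨⟩ baseVertex)) (ℤ.*-identityʳ (+ s)))
      s≤deg : + s ≤ deg D
      s≤deg with p E effE degE
      ... | E′ , eff , D-E∼E′ = ℤ.0≤i-j⇒j≤i (subst (0ℤ ≤_)
              (trans (sym (deg-∼ D-E∼E′)) (trans (deg-- D E) (cong (λ z → deg D - z) degE))) (sum-nonneg eff))

    largest : (P : ℕ → Set) → (∀ n → Dec (P n)) → P 0 → ∀ B →
              ∃[ r ] (P r × (∀ s → s ℕ.≤ B → P s → s ℕ.≤ r))
    largest P P? p0 zero = 0 , p0 , λ s s≤B _ → s≤B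
    largest P P? p0 (suc B) with P? (suc B)
    ... | yes p = suc B , p , λ s s≤B _ → s≤B
    ... | no ¬p with largest P P? p0 B
    ...   | r , pr , max = r , pr , λ s s≤1+B ps → max s (ℕ.≤-pred (ℕ.≤∧≢⇒< s≤1+B (λ { refl → ¬p ps }))) ps

  abstract
    rankExists : ∀ D → ∃[ r ] IsRank D r
    rankExists D with nonEmpty? D
    ... | no ¬p = -1ℤ , rank-empty ¬p
    ... | yes p with largest (RankAtLeast D) (rankAtLeast? D) (rankAtLeast-0 D p) ∣ deg D ∣
    ...   | r , pr , max = + r , rank-nonempty r p pr (λ s ps → max s (rankAtLeast-bound D s ps) ps)

  -- rankExists is abstract: rank is to be used through rank-isRank.
  rank : Divisor → ℤ
  rank D = proj₁ (rankExists D)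

  rank-isRank : ∀ D → IsRank D (rank D)
  rank-isRank D = proj₂ (rankExists D)

  -- The Jacobian, by representatives; classes are compared with _∼_

  Jac : Set
  Jac = Σ Divisor λ D → deg D ≡ 0ℤ

  HasOrder : Jac → ℕ → Set
  HasOrder (D , _) = IsLeastPositive λ k → + k ·ᵈ D ∼ 0ᵈ

  NonRecurrent : Jac → Set
  NonRecurrent c@(D , _) = ∃[ k ] (HasOrder c k ×
    (∀ w m n → 1 ℕ.≤ m → m ℕ.< k → 1 ℕ.≤ n → n ℕ.< k →
     NonEmpty∣ + m ·ᵈ D +ᵈ ⟨ w ⟩ ∣ → NonEmpty∣ + n ·ᵈ D +ᵈ ⟨ w ⟩ ∣ → m ≡ n))

record Inversion (τ : ℤ → ℤ) : Set where
  field
    fst snd  : ℤ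
    fst<snd  : fst < snd
    inverted : τ snd < τ fst

open Inversion public

_≈[_]_ : ∀ {τ} → Inversion τ → ℕ → Inversion τ → Set
p ≈[ k ] q = (fst p - fst q ≡ snd p - snd q) × (+ k ∣ fst p - fst q)

-- inv_k(τ) = N: some N inversions form a system of representatives of
-- the k-equivalence classes.
IsInv : ℕ → (ℤ → ℤ) → ℕ → Set
IsInv k τ N = Σ (Fin N → Inversion τ) λ rep →
  (∀ i j → rep i ≈[ k ] rep j → i ≡ j) × (∀ p → ∃[ i ] p ≈[ k ] rep i)

record TwiceMarkedGraph : Set where
  field
    graph : Graph
    u v   : ChipFiring.Vertex graph

module _ (M : TwiceMarkedGraph) where
  open TwiceMarkedGraph M
  open ChipFiring graph

  HasTorsionOrder : ℕ → Set
  HasTorsionOrder = IsLeastPositive λ k → + k ·ᵈ ⟨ u ⟩ ∼ + k ·ᵈ ⟨ v ⟩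

  Δ : Divisor → ℤ
  Δ D = rank D - rank (D -ᵈ ⟨ u ⟩) - rank (D -ᵈ ⟨ v ⟩) + rank (D -ᵈ ⟨ u ⟩ -ᵈ ⟨ v ⟩)

  Submodular : Divisor → Set
  Submodular D = ∀ (a b : ℤ) → 0ℤ ≤ Δ (D +ᵈ a ·ᵈ ⟨ u ⟩ +ᵈ b ·ᵈ ⟨ v ⟩)

  IsTransmissionPermutation : Divisor → (ℤ → ℤ) → Set
  IsTransmissionPermutation D τ = Bijective _≡_ _≡_ τ ×
    (∀ a b → δ (τ b ℤ.≟ a) ≡ Δ (D +ᵈ a ·ᵈ ⟨ u ⟩ -ᵈ b ·ᵈ ⟨ v ⟩))

  transmissionPermutation-unique : ∀ {D τ τ′} →
    IsTransmissionPermutation D τ → IsTransmissionPermutation D τ′ → τ ≗ τ′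
  transmissionPermutation-unique {τ = τ} {τ′} (_ , p) (_ , q) b
    with τ b ℤ.≟ τ b | τ′ b ℤ.≟ τ b | trans (p (τ b) b) (sym (q (τ b) b))
  ... | _    | yes e | _ = sym e
  ... | no n | no _  | _ = contradiction refl n

  -- The transmission permutation of a submodular divisor exists and is
  -- unique, so ∃[ τ ] below names it; likewise ∃[ N ] names inv_k(τ).
  HasGeneralTransmission : ℕ → Set
  HasGeneralTransmission k =
    (+ k ·ᵈ ⟨ u ⟩ ∼ + k ·ᵈ ⟨ v ⟩) ×
    (∀ D → Submodular D) ×
    (∀ D → ∃[ τ ] (IsTransmissionPermutation D τ × ∃[ N ] (IsInv k τ N × + N ≤ genus)))

  RigidlyMarked : Set
  RigidlyMarked = (∀ D → Submodular D) × rank (⟨ u ⟩ +ᵈ ⟨ v ⟩) ≡ 0ℤ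

  [u-v] : Jac
  [u-v] = ⟨ u ⟩ -ᵈ ⟨ v ⟩ ,
    trans (deg-- ⟨ u ⟩ ⟨ v ⟩) (cong₂ _-_ (deg-⟨⟩ u) (deg-⟨⟩ v))

{-# OPTIONS --safe #-}

-- Write r(a, i) for the rank of D + a u + i v.  Submodularity makes τ_D the
-- permutation that records the jumps of r, so that r(a, i) + 1 counts the
-- points of its graph on one side of (a, i) and, since r = deg - 2 in degree
-- at least 3, r(a, i) - (deg - 2) counts those strictly on the opposite side.
-- An inversion is therefore a box of twists (a, i) that have a point below
-- and a point above.  In genus 2, rigidity (r(u + v) = 0) forces each box to
-- contain exactly one twist of degree 1, which is effective; conversely each
-- effective twist of degree 1 has rank 0 and lies in exactly one box.  Hence
-- inv_k(τ_D) is the number of effective classes in an orbit of [u - v] on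
-- Pic¹(G), and having at most two of them in every orbit is non-recurrence.
module Submission where

-- The value r = deg - 2 in degree at least 3 joins two bounds. The lower one, r(D) ≥ deg D - g,
-- holds because every divisor of degree at least g is effective, which is shown by Dhar's burning
-- algorithm. The upper one comes out of rigidity itself, u + v being a divisor of degree 2 and rank
-- 0. Degree 1 is the critical degree because deg - 2 = -1 there: both counts are then r + 1, so
-- that effectiveness yields a point on either side and r = 0 makes both points unique. The
-- exclusions all go through u + v. An effective class of degree 0 is trivial, so the twist
-- diagonally across a unit square from it is u + v, of rank 0. Two twists of degree 1 in one box, a
-- box with lower corner of degree 2, or a unit box with lower corner of degree 0 would each give
-- that twist positive rank. Two effective classes in an orbit match one n in the definition of
-- non-recurrence because an effective class of degree 1 is a vertex w: counting the orbit from w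
-- puts one of the two at n = 0.

open import Defs
open import Data.Empty using (⊥)
open import Data.Fin.Base as Fin using (Fin; toℕ; fromℕ<)
open import Data.Fin.Patterns using (0F; 1F; 2F)
open import Data.Fin.Properties as Fin using (_≟_; any?; pigeonhole; toℕ<n; toℕ-fromℕ<)
open import Data.Integer.Base using (ℤ; +_; -[1+_]; 0ℤ; 1ℤ; -1ℤ; _+_; _-_; -_; _*_; _/ℕ_; _%ℕ_; _≤_; _<_; ∣_∣; +≤+; -≤+; -≤-; -<+; nonNegative)
open import Data.Integer.Divisibility using (_∣_)
open import Data.Integer.Divisibility.Signed as Signed using (∣ᵤ⇒∣; ∣⇒∣ᵤ; divides)
open import Data.Integer.DivMod using (a≡a%ℕn+[a/ℕn]*n; n%ℕd<d)
import Data.Integer.Properties as ℤ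
open import Data.Integer.Tactic.RingSolver using (solve-∀)
open import Data.Nat.Base as ℕ using (ℕ; zero; suc; z≤n; s≤s; NonZero)
import Data.Nat.Divisibility as ℕ
import Data.Nat.Properties as ℕ
open import Data.Product.Base using (Σ; ∃-syntax; _×_; _,_; proj₁; proj₂)
open import Data.Sum.Base using (_⊎_; inj₁; inj₂)
open import Data.Unit.Base using (⊤)
open import Function.Base using (_∘_)
open import Function.Bundles using (_⇔_; mk⇔)
open import Function.Definitions using (Bijective)
open import Relation.Binary.Construct.Closure.Equivalence using (EqClosure)
open import Relation.Binary.Construct.Closure.ReflexiveTransitive using (ε; _◅_; _◅◅_)
open import Relation.Binary.Construct.Closure.Symmetric using (fwd; bwd)
open import Relation.Binary.Definitions using (tri<; tri≈; tri>)
open import Relation.Binary.PropositionalEquality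
open import Relation.Nullary using (¬_; Dec; yes; no; contradiction)
open import Relation.Nullary.Decidable using (_×-dec_)

-- Integers and finite sums

gap : ∀ {i j} → i ≤ j → 0ℤ ≤ j - i
gap = ℤ.i≤j⇒0≤j-i

infixl 6 _⊕_
_⊕_ : ∀ {i j} → 0ℤ ≤ i → 0ℤ ≤ j → 0ℤ ≤ i + j
_⊕_ = ℤ.+-mono-≤

0≤+ : ∀ n → 0ℤ ≤ + n
0≤+ n = +≤+ z≤n

-- Linear arithmetic: i ≤ j is certified by writing j - i as a sum s of
-- gaps of known inequalities.
linear : ∀ {i j s} → 0ℤ ≤ s → j - i ≡ s → i ≤ j
linear 0≤s eq = ℤ.0≤i-j⇒j≤i (subst (0ℤ ≤_) (sym eq) 0≤s)

-- The counterpart of `linear` for contradictions: the gaps of the assumed inequalities add up to a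
-- negative constant.
absurd-gap : ∀ {a} {A : Set a} {n s} → 0ℤ ≤ s → s ≡ -[1+ n ] → A
absurd-gap p refl with () ← p

<⇒1+≤ : ∀ {i j} → i < j → i + 1ℤ ≤ j
<⇒1+≤ {i} {j} p = subst (_≤ j) (ℤ.+-comm 1ℤ i) (ℤ.i<j⇒suc[i]≤j p)

1+≤⇒< : ∀ {i j} → i + 1ℤ ≤ j → i < j
1+≤⇒< {i} {j} p = ℤ.suc[i]≤j⇒i<j (subst (_≤ j) (ℤ.+-comm i 1ℤ) p)

≰⇒1+≤ : ∀ {i j} → ¬ i ≤ j → j + 1ℤ ≤ i
≰⇒1+≤ p = <⇒1+≤ (ℤ.≰⇒> p)

*-nonneg : ∀ {i j} → 0ℤ ≤ i → 0ℤ ≤ j → 0ℤ ≤ i * j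
*-nonneg {i} {j} p q = subst (_≤ i * j) (ℤ.*-zeroʳ i) (ℤ.*-monoˡ-≤-nonNeg i {{nonNegative p}} q)

0≤∣i∣+i : ∀ i → 0ℤ ≤ + ∣ i ∣ + i
0≤∣i∣+i (+ n)      = 0≤+ _
0≤∣i∣+i (-[1+ n ]) = ℤ.≤-reflexive (sym (ℤ.+-inverseʳ (+ suc n)))

sum-mono : ∀ {n} {f g : Fin n → ℤ} → (∀ i → f i ≤ g i) → sum f ≤ sum g
sum-mono {zero}  p = ℤ.≤-refl
sum-mono {suc n} p = ℤ.+-mono-≤ (p Fin.zero) (sum-mono (p ∘ Fin.suc))

sum-nonneg : ∀ {n} {f : Fin n → ℤ} → (∀ i → 0ℤ ≤ f i) → 0ℤ ≤ sum f
sum-nonneg {n} {f} p = subst (_≤ sum f) (sum-replicate-zero n) (sum-mono p)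

term≤sum : ∀ {n} {f : Fin n → ℤ} → (∀ i → 0ℤ ≤ f i) → ∀ i → f i ≤ sum f
term≤sum {f = f} p Fin.zero    = subst (_≤ sum f) (ℤ.+-identityʳ _)
                                   (ℤ.+-monoʳ-≤ (f Fin.zero) (sum-nonneg (p ∘ Fin.suc)))
term≤sum {f = f} p (Fin.suc i) = subst (_≤ sum f) (ℤ.+-identityˡ _)
                                   (ℤ.+-mono-≤ (p Fin.zero) (term≤sum (p ∘ Fin.suc) i))

sum-one : ∀ n → sum {n} (λ _ → 1ℤ) ≡ + n
sum-one zero    = refl
sum-one (suc n) = cong (λ z → 1ℤ + z) (sum-one n)

δ-suc : ∀ {n} (i j : Fin n) → δ (Fin.suc i ≟ Fin.suc j) ≡ δ (i ≟ j)
δ-suc i j with i ≟ j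
... | yes _ = refl
... | no  _ = refl

δ-sym : ∀ {n} (i j : Fin n) → δ (i ≟ j) ≡ δ (j ≟ i)
δ-sym i j with i ≟ j | j ≟ i
... | yes _ | yes _ = refl
... | no _  | no _  = refl
... | yes p | no q  = contradiction (sym p) q
... | no p  | yes q = contradiction (sym q) p

0≤δ : ∀ {p} {P : Set p} (P? : Dec P) → 0ℤ ≤ δ P?
0≤δ (yes _) = 0≤+ 1
0≤δ (no _)  = 0≤+ 0

sum-*-δ : ∀ {n} (g : Fin n → ℤ) (a : Fin n) → sum (λ x → g x * δ (x ≟ a)) ≡ g a
sum-*-δ {suc n} g Fin.zero = trans
  (cong₂ _+_ (ℤ.*-identityʳ (g Fin.zero))
    (trans (sum-cong-≗ (λ x → ℤ.*-zeroʳ (g (Fin.suc x)))) (sum-replicate-zero n)))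
  (ℤ.+-identityʳ _)
sum-*-δ {suc n} g (Fin.suc a) = trans
  (cong₂ _+_ (ℤ.*-zeroʳ (g Fin.zero)) (sum-cong-≗ (λ x → cong (g (Fin.suc x) *_) (δ-suc x a))))
  (trans (ℤ.+-identityˡ _) (sum-*-δ (g ∘ Fin.suc) a))

sum-linear : ∀ {n} c (f g : Fin n → ℤ) → sum (λ x → c * f x + g x) ≡ c * sum f + sum g
sum-linear c f g = trans (∑-distrib-+ (λ x → c * f x) g) (cong (_+ sum g) (sym (*-distribˡ-sum c f)))

-- Divisors of degree at least g are effective

module _ (G : Graph) where
  open Graph G
  open ChipFiring G

  nonEmpty-resp-∼ : ∀ {D D′} → D ∼ D′ → NonEmpty∣ D ∣ → NonEmpty∣ D′ ∣
  nonEmpty-resp-∼ D∼D′ (E , eff , D∼E) = E , eff , ∼-sym D∼D′ ◅◅ D∼E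

  -- The laplacian: linearity and summation by parts

  laplacian-linear : ∀ c f g x → laplacian (λ y → c * f y + g y) x ≡ c * laplacian f x + laplacian g x
  laplacian-linear c f g x = trans
    (sum-cong-≗ (λ e → lemma c (f (src e)) (g (src e)) (f (tgt e)) (g (tgt e)) (boundary e x)))
    (sum-linear c (λ e → (f (src e) - f (tgt e)) * boundary e x) (λ e → (g (src e) - g (tgt e)) * boundary e x))
    where
    lemma : ∀ c a b a′ b′ z → (c * a + b - (c * a′ + b′)) * z ≡ c * ((a - a′) * z) + (b - b′) * z
    lemma = solve-∀

  laplacian-cong : ∀ {f g} → f ≗ g → laplacian f ≗ laplacian g
  laplacian-cong p x = sum-cong-≗ (λ e → cong₂ (λ a b → (a - b) * boundary e x) (p (src e)) (p (tgt e)))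

  laplacian-const : ∀ c x → laplacian (λ _ → c) x ≡ 0ℤ
  laplacian-const c x = trans (sum-cong-≗ (λ e → lemma c (boundary e x))) (sum-replicate-zero #E)
    where
    lemma : ∀ c z → (c - c) * z ≡ 0ℤ
    lemma = solve-∀

  laplacian-· : ∀ c f x → laplacian (λ y → c * f y) x ≡ c * laplacian f x
  laplacian-· c f x = begin
    laplacian (λ y → c * f y) x                       ≡⟨ laplacian-cong (λ y → sym (ℤ.+-identityʳ (c * f y))) x ⟩
    laplacian (λ y → c * f y + 0ℤ) x                  ≡⟨ laplacian-linear c f (λ _ → 0ℤ) x ⟩
    c * laplacian f x + laplacian (λ _ → 0ℤ) x        ≡⟨ cong (λ z → c * laplacian f x + z) (laplacian-const 0ℤ x) ⟩
    c * laplacian f x + 0ℤ                            ≡⟨ ℤ.+-identityʳ _ ⟩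
    c * laplacian f x                                 ∎
    where open ≡-Reasoning

  laplacian-sum : ∀ {n} (F : Fin n → Vertex → ℤ) x → laplacian (λ y → sum (λ i → F i y)) x ≡ sum (λ i → laplacian (F i) x)
  laplacian-sum {zero}  F x = laplacian-const 0ℤ x
  laplacian-sum {suc n} F x = begin
    laplacian (λ y → F Fin.zero y + sum (λ i → F (Fin.suc i) y)) x
      ≡⟨ laplacian-cong (λ y → cong (_+ sum (λ i → F (Fin.suc i) y)) (sym (ℤ.*-identityˡ (F Fin.zero y)))) x ⟩
    laplacian (λ y → 1ℤ * F Fin.zero y + sum (λ i → F (Fin.suc i) y)) x
      ≡⟨ laplacian-linear 1ℤ (F Fin.zero) (λ y → sum (λ i → F (Fin.suc i) y)) x ⟩
    1ℤ * laplacian (F Fin.zero) x + laplacian (λ y → sum (λ i → F (Fin.suc i) y)) x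
      ≡⟨ cong₂ _+_ (ℤ.*-identityˡ (laplacian (F Fin.zero) x)) (laplacian-sum (F ∘ Fin.suc) x) ⟩
    laplacian (F Fin.zero) x + sum (λ i → laplacian (F (Fin.suc i)) x) ∎
    where open ≡-Reasoning

  -- The discrete Green identity. The right-hand side is symmetric in `f` and `g`, which makes the
  -- laplacian self-adjoint.
  green : ∀ f g → sum (λ x → g x * laplacian f x) ≡ sum (λ e → (f (src e) - f (tgt e)) * (g (src e) - g (tgt e)))
  green f g = begin
    sum (λ x → g x * laplacian f x)
      ≡⟨ sum-cong-≗ (λ x → *-distribˡ-sum (g x) (λ e → df e * boundary e x)) ⟩
    sum (λ x → sum (λ e → g x * (df e * boundary e x)))
      ≡⟨ ∑-comm (λ x e → g x * (df e * boundary e x)) ⟩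
    sum (λ e → sum (λ x → g x * (df e * boundary e x)))
      ≡⟨ sum-cong-≗ edge ⟩
    sum (λ e → df e * (g (src e) - g (tgt e))) ∎
    where
    open ≡-Reasoning
    df : Edge → ℤ
    df e = f (src e) - f (tgt e)
    rearrange : ∀ g d a b → g * (d * (a - b)) ≡ d * (g * a) + (- d) * (g * b)
    rearrange = solve-∀
    collect : ∀ d a b → d * a + (- d) * b ≡ d * (a - b)
    collect = solve-∀
    at : ∀ w → sum (λ x → g x * δ (w ≟ x)) ≡ g w
    at w = trans (sum-cong-≗ (λ x → cong (g x *_) (δ-sym w x))) (sum-*-δ g w)
    edge : ∀ e → sum (λ x → g x * (df e * boundary e x)) ≡ df e * (g (src e) - g (tgt e))
    edge e = begin
      sum (λ x → g x * (df e * boundary e x))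
        ≡⟨ sum-cong-≗ (λ x → rearrange (g x) (df e) (δ (src e ≟ x)) (δ (tgt e ≟ x))) ⟩
      sum (λ x → df e * (g x * δ (src e ≟ x)) + (- df e) * (g x * δ (tgt e ≟ x)))
        ≡⟨ sum-linear (df e) (λ x → g x * δ (src e ≟ x)) (λ x → (- df e) * (g x * δ (tgt e ≟ x))) ⟩
      df e * sum (λ x → g x * δ (src e ≟ x)) + sum (λ x → (- df e) * (g x * δ (tgt e ≟ x)))
        ≡⟨ cong₂ (λ a b → df e * a + b) (at (src e))
             (trans (sym (*-distribˡ-sum (- df e) (λ x → g x * δ (tgt e ≟ x)))) (cong ((- df e) *_) (at (tgt e)))) ⟩
      df e * g (src e) + (- df e) * g (tgt e)
        ≡⟨ collect (df e) (g (src e)) (g (tgt e)) ⟩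
      df e * (g (src e) - g (tgt e)) ∎

  green-sym : ∀ f g → sum (λ x → g x * laplacian f x) ≡ sum (λ x → f x * laplacian g x)
  green-sym f g = trans (green f g)
    (trans (sum-cong-≗ (λ e → ℤ.*-comm (f (src e) - f (tgt e)) (g (src e) - g (tgt e)))) (sym (green g f)))

  -- The maximum principle

  Maximum : (Vertex → ℤ) → Vertex → Set
  Maximum f x = ∀ y → f y ≤ f x

  laplacian-term-nonneg : ∀ {f x} → Maximum f x → ∀ e → 0ℤ ≤ (f (src e) - f (tgt e)) * boundary e x
  laplacian-term-nonneg {f} {x} max e with src e ≟ x | tgt e ≟ x
  ... | yes _    | yes _    = ℤ.≤-reflexive (sym (ℤ.*-zeroʳ (f (src e) - f (tgt e))))
  ... | no _     | no _     = ℤ.≤-reflexive (sym (ℤ.*-zeroʳ (f (src e) - f (tgt e))))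
  ... | yes refl | no _     = subst (0ℤ ≤_) (sym (ℤ.*-identityʳ _)) (gap (max (tgt e)))
  ... | no _     | yes refl = subst (0ℤ ≤_) (flip (f (src e)) (f (tgt e))) (gap (max (src e)))
    where
    flip : ∀ a b → b - a ≡ (a - b) * -1ℤ
    flip = solve-∀

  laplacian-maximum : ∀ {f x} → Maximum f x → 0ℤ ≤ laplacian f x
  laplacian-maximum max = sum-nonneg (laplacian-term-nonneg max)

  Neighbours : Vertex → Vertex → Set
  Neighbours x y = ∃[ e ] ((src e ≡ x × tgt e ≡ y) ⊎ (tgt e ≡ x × src e ≡ y))

  laplacian-strict-maximum : ∀ {f x y} → Maximum f x → Neighbours x y → f y < f x → 1ℤ ≤ laplacian f x
  laplacian-strict-maximum {f} {x} {y} max (e , ends) fy<fx = ℤ.≤-trans (term ends) (term≤sum (laplacian-term-nonneg max) e)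
    where
    term : (src e ≡ x × tgt e ≡ y) ⊎ (tgt e ≡ x × src e ≡ y) → 1ℤ ≤ (f (src e) - f (tgt e)) * boundary e x
    term (inj₁ (refl , refl)) with src e ≟ src e | tgt e ≟ src e
    ... | no ¬p | _     = contradiction refl ¬p
    ... | yes _ | yes p = contradiction (sym p) (loopless e)
    ... | yes _ | no _  = linear (gap (<⇒1+≤ fy<fx)) (lemma (f (src e)) (f (tgt e)))
      where
      lemma : ∀ a b → (a - b) * 1ℤ - 1ℤ ≡ a - (b + 1ℤ)
      lemma = solve-∀
    term (inj₂ (refl , refl)) with src e ≟ tgt e | tgt e ≟ tgt e
    ... | _     | no ¬p = contradiction refl ¬p
    ... | yes p | _     = contradiction p (loopless e)
    ... | no _  | yes _ = linear (gap (<⇒1+≤ fy<fx)) (lemma (f (src e)) (f (tgt e)))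
      where
      lemma : ∀ a b → (a - b) * -1ℤ - 1ℤ ≡ b - (a + 1ℤ)
      lemma = solve-∀

  -- Potentials: functions with positive laplacian away from a base vertex

  module _ (q : Vertex) where

    record Superharmonic (h : Vertex → ℤ) : Set where
      field
        at-base        : h q ≡ 0ℤ
        off-base       : ∀ x → x ≢ q → 1ℤ ≤ h x
        laplacian-off  : ∀ x → x ≢ q → 0ℤ ≤ laplacian h x

    open Superharmonic

    drop-maximum : ∀ {x} c y → x ≢ y → Maximum (λ z → c - ⟨ y ⟩ z) x
    drop-maximum {x} c y x≢y z with x ≟ y
    ... | yes x≡y = contradiction x≡y x≢y
    ... | no _    = linear (0≤δ (z ≟ y)) (lemma c (δ (z ≟ y)))
      where
      lemma : ∀ c a → (c - 0ℤ) - (c - a) ≡ a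
      lemma = solve-∀

    drop-< : ∀ {x y} c → x ≢ y → c - ⟨ y ⟩ y < c - ⟨ y ⟩ x
    drop-< {x} {y} c x≢y with x ≟ y | y ≟ y
    ... | yes x≡y | _     = contradiction x≡y x≢y
    ... | no _    | no ¬p = contradiction refl ¬p
    ... | no _    | yes _ = ℤ.+-monoʳ-< c { -1ℤ} {0ℤ} -<+

    complement-superharmonic : Superharmonic (λ z → 1ℤ - ⟨ q ⟩ z)
    complement-superharmonic .at-base with q ≟ q
    ... | yes _ = refl
    ... | no ¬p = contradiction refl ¬p
    complement-superharmonic .off-base x x≢q with x ≟ q
    ... | yes x≡q = contradiction x≡q x≢q
    ... | no _    = ℤ.≤-refl
    complement-superharmonic .laplacian-off x x≢q = laplacian-maximum (drop-maximum 1ℤ q x≢q)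

    -- Strictness is carried outwards from `q` along a walk, one vertex at a time. Each vertex may
    -- have its own `h`: in the sum of all of them the laplacians off `q` cannot cancel, so the sum
    -- is strict everywhere.
    StrictAt : Vertex → Set
    StrictAt x = ∃[ h ] (Superharmonic h × (x ≢ q → 1ℤ ≤ laplacian h x))

    -- A multiple c h can afford to be lowered by 1 at y, which raises the
    -- laplacian at the neighbours of y.
    strict-neighbour : ∀ {x y} → Neighbours x y → StrictAt y → StrictAt x
    strict-neighbour {x} {y} xy (h , super , strict) with x ≟ y | y ≟ q
    ... | yes refl | _        = h , super , strict
    ... | no x≢y   | yes refl = _ , complement-superharmonic , λ x≢q →
            laplacian-strict-maximum (drop-maximum 1ℤ q x≢q) xy (drop-< 1ℤ x≢q)
    ... | no x≢y   | no y≢q   = h′ , super′ , λ x≢q → linear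
            (*-nonneg 0≤c (super .laplacian-off x x≢q) ⊕
             gap (laplacian-strict-maximum (drop-maximum 0ℤ y x≢y) xy (drop-< 0ℤ x≢y)))
            (trans (cong (_- 1ℤ) (laplacian-linear c h g x)) (ℤ.+-assoc (c * laplacian h x) (laplacian g x) -1ℤ))
      where
      g : Vertex → ℤ
      g z = 0ℤ - ⟨ y ⟩ z
      -- The laplacian of `g` at `y` is minus the valence of `y`; as `h` is strict at `y`, the
      -- multiple `m` outweighs it. The extra 2 keeps `h′` at least 1 off `q`, where `g` may
      -- subtract 1.
      m c : ℤ
      m = + ∣ laplacian g y ∣
      c = + 2 + m
      0≤m : 0ℤ ≤ m
      0≤m = 0≤+ _
      0≤1+m : 0ℤ ≤ 1ℤ + m
      0≤1+m = 0≤+ _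
      0≤c : 0ℤ ≤ c
      0≤c = 0≤+ _
      h′ : Vertex → ℤ
      h′ z = c * h z + g z
      base : ∀ c a b → a ≡ 0ℤ → b ≡ 0ℤ → c * a + (0ℤ - b) ≡ 0ℤ
      base c _ _ refl refl = trans (ℤ.+-identityʳ (c * 0ℤ)) (ℤ.*-zeroʳ c)
      off : ∀ a b m → (+ 2 + m) * a + (0ℤ - b) - 1ℤ ≡ (a - 1ℤ) + ((1ℤ + m) * (a - 1ℤ) + m) + (1ℤ - b)
      off = solve-∀
      δ≤1 : ∀ z → ⟨ y ⟩ z ≤ 1ℤ
      δ≤1 z with z ≟ y
      ... | yes _ = ℤ.≤-refl
      ... | no _  = 0≤+ 1
      q∉y : ⟨ y ⟩ q ≡ 0ℤ
      q∉y with q ≟ y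
      ... | yes refl = contradiction refl y≢q
      ... | no _     = refl
      atY : ∀ l a m → (+ 2 + m) * l + a - 0ℤ ≡ (+ 2 + m) * (l - 1ℤ) + + 2 + (m + a)
      atY = solve-∀
      super′ : Superharmonic h′
      super′ .at-base        = base c (h q) (⟨ y ⟩ q) (super .at-base) q∉y
      super′ .off-base z z≢q = linear
        (gap (super .off-base z z≢q) ⊕ (*-nonneg 0≤1+m (gap (super .off-base z z≢q)) ⊕ 0≤m) ⊕ gap (δ≤1 z))
        (off (h z) (⟨ y ⟩ z) m)
      super′ .laplacian-off z z≢q with z ≟ y
      ... | no z≢y   = subst (0ℤ ≤_) (sym (laplacian-linear c h g z))
              (*-nonneg 0≤c (super .laplacian-off z z≢q) ⊕ laplacian-maximum {g} {z} (drop-maximum 0ℤ y z≢y))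
      ... | yes refl = subst (0ℤ ≤_) (sym (laplacian-linear c h g y)) (linear
              (*-nonneg 0≤c (gap (strict z≢q)) ⊕ 0≤+ 2 ⊕ 0≤∣i∣+i (laplacian g y))
              (atY (laplacian h y) (laplacian g y) m))

    strict-everywhere : ∀ x → StrictAt x
    strict-everywhere x = along (connected x q)
      where
      along : ∀ {x} → EqClosure (Adjacent src tgt (λ _ → ⊤)) x q → StrictAt x
      along ε                              = _ , complement-superharmonic , λ q≢q → contradiction refl q≢q
      along (fwd (e , _ , p , p′) ◅ walk) = strict-neighbour (e , inj₁ (p , p′)) (along walk)
      along (bwd (e , _ , p , p′) ◅ walk) = strict-neighbour (e , inj₂ (p′ , p)) (along walk)

    -- Serves twice: firing a negative multiple of `h` makes a divisor effective off `q`, and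
    -- pairing divisors with `h` gives the measure by which legal firings terminate.
    record Potential (h : Vertex → ℤ) : Set where
      field
        superharmonic : Superharmonic h
        strict        : ∀ x → x ≢ q → 1ℤ ≤ laplacian h x

    open Potential

    abstract
      potential-exists : ∃[ h ] Potential h
      potential-exists = (λ y → sum (λ x → h x y)) , record
        { superharmonic = record
          { at-base       = trans (sum-cong-≗ (λ x → super x .at-base)) (sum-replicate-zero #V)
          ; off-base      = λ x x≢q → ℤ.≤-trans (super x .off-base x x≢q)
                              (term≤sum (λ y → ℤ.≤-trans (0≤+ 1) (super y .off-base x x≢q)) x)
          ; laplacian-off = λ x x≢q → ℤ.≤-trans (0≤+ 1) (strict-sum x x≢q)
          }
        ; strict = strict-sum
        }
        where
        h : Vertex → Vertex → ℤ
        h x = proj₁ (strict-everywhere x)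
        super : ∀ x → Superharmonic (h x)
        super x = proj₁ (proj₂ (strict-everywhere x))
        strict-sum : ∀ x → x ≢ q → 1ℤ ≤ laplacian (λ y → sum (λ x → h x y)) x
        strict-sum x x≢q = subst (1ℤ ≤_) (sym (laplacian-sum h x))
          (ℤ.≤-trans (proj₂ (proj₂ (strict-everywhere x)) x≢q)
            (term≤sum (λ y → super y .laplacian-off x x≢q) x))

    -- Divisors effective off the base vertex, and burning

    EffectiveOff : Divisor → Set
    EffectiveOff D = ∀ x → x ≢ q → 0ℤ ≤ D x

    -- Firing `- N * h` adds at least `N` chips at every vertex other than `q`, and `N` is the total
    -- of all ∣D y∣.
    effectiveOff-representative : ∀ {h} → Potential h → ∀ D → ∃[ D′ ] (D ∼ D′ × EffectiveOff D′)
    effectiveOff-representative {h} pot D = _ , script⇒∼ (f , λ _ → refl) , λ x x≢q →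
      subst (0ℤ ≤_) (cong (λ z → D x - z) (sym (laplacian-· (- N) h x)))
        (linear (gap (term≤sum {f = λ y → + ∣ D y ∣} (λ y → 0≤+ _) x)
                 ⊕ *-nonneg 0≤N (gap (pot .strict x x≢q)) ⊕ 0≤∣i∣+i (D x))
          (lemma (D x) N (laplacian h x) (+ ∣ D x ∣)))
      where
      N : ℤ
      N = sum (λ y → + ∣ D y ∣)
      0≤N : 0ℤ ≤ N
      0≤N = sum-nonneg {f = λ y → + ∣ D y ∣} (λ y → 0≤+ _)
      f : Vertex → ℤ
      f y = - N * h y
      lemma : ∀ d n l a → d - (- n * l) - 0ℤ ≡ (n - a) + n * (l - 1ℤ) + (a + d)
      lemma = solve-∀

    -- For `D` effective off `q`, the absence of such a script is what it means for `D` to be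
    -- `q`-reduced, phrased with scripts instead of sets of vertices.
    record LegalFiring (D : Divisor) : Set where
      field
        script      : Vertex → ℤ
        nonneg      : ∀ x → 0ℤ ≤ script x
        fixes-base  : script q ≡ 0ℤ
        fired       : ∃[ x ] 1ℤ ≤ script x
        legal       : EffectiveOff (D -ᵈ laplacian script)

    open LegalFiring

    IsIndicator : (Vertex → ℤ) → Set
    IsIndicator φ = ∀ x → φ x ≡ 0ℤ ⊎ φ x ≡ 1ℤ

    indicator-≥0 : ∀ {φ} → IsIndicator φ → ∀ x → 0ℤ ≤ φ x
    indicator-≥0 ind x with ind x
    ... | inj₁ p = ℤ.≤-reflexive (sym p)
    ... | inj₂ p = subst (0ℤ ≤_) (sym p) (0≤+ 1)

    indicator-≤1 : ∀ {φ} → IsIndicator φ → ∀ x → φ x ≤ 1ℤ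
    indicator-≤1 ind x with ind x
    ... | inj₁ p = subst (_≤ 1ℤ) (sym p) (0≤+ 1)
    ... | inj₂ p = ℤ.≤-reflexive p

    -- Dhar's burning algorithm; φ is the indicator of the burnt set.  Each
    -- burnt vertex has fewer chips than edges to vertices burnt before it,
    -- which is the invariant, so if everything burns then D has degree < g.
    burn : ∀ D → EffectiveOff D → + #E + 1ℤ ≤ deg D + + #V →
           ∀ m φ → IsIndicator φ → φ q ≡ 1ℤ → sum (λ x → 1ℤ - φ x) ≤ + m →
           sum (λ x → φ x * (D x + 1ℤ)) ≤ sum (λ e → φ (src e) * φ (tgt e)) →
           LegalFiring D
    burn D eff large m φ ind φq size inv
      -- At an unburnt `x`, `- laplacian φ x` is the number of edges from `x` to burnt vertices, so
      -- the test asks for fewer chips than such edges.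
      with any? (λ x → (φ x ℤ.≟ 0ℤ) ×-dec (D x + 1ℤ ℤ.≤? - laplacian φ x)) | any? (λ x → φ x ℤ.≟ 0ℤ)
    -- The fire has stopped early. Each unburnt vertex has a chip for every edge to the burnt set,
    -- so the unburnt set can be fired.
    ... | no stuck | yes (z , φz) = record
      { script     = ψ
      ; nonneg     = λ x → gap (indicator-≤1 ind x)
      ; fixes-base = cong (λ t → 1ℤ - t) φq
      ; fired      = z , ℤ.≤-reflexive (cong (λ t → 1ℤ - t) (sym φz))
      ; legal      = λ x x≢q → subst (0ℤ ≤_) (cong (λ t → D x - t) (sym (Lψ x))) (legal-at x x≢q (ind x))
      }
      where
      ψ : Vertex → ℤ
      ψ x = 1ℤ - φ x
      Lψ : ∀ x → laplacian ψ x ≡ - laplacian φ x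
      Lψ x = begin
        laplacian ψ x                                  ≡⟨ laplacian-cong (λ y → flip (φ y)) x ⟩
        laplacian (λ y → -1ℤ * φ y + 1ℤ) x             ≡⟨ laplacian-linear -1ℤ φ (λ _ → 1ℤ) x ⟩
        -1ℤ * laplacian φ x + laplacian (λ _ → 1ℤ) x   ≡⟨ cong (λ t → -1ℤ * laplacian φ x + t) (laplacian-const 1ℤ x) ⟩
        -1ℤ * laplacian φ x + 0ℤ                       ≡⟨ unflip (laplacian φ x) ⟩
        - laplacian φ x                                ∎
        where
        open ≡-Reasoning
        flip : ∀ a → 1ℤ - a ≡ -1ℤ * a + 1ℤ
        flip = solve-∀
        unflip : ∀ a → -1ℤ * a + 0ℤ ≡ - a
        unflip = solve-∀
      legal-at : ∀ x → x ≢ q → φ x ≡ 0ℤ ⊎ φ x ≡ 1ℤ → 0ℤ ≤ D x - - laplacian φ x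
      legal-at x x≢q (inj₁ φx) = linear (gap (≰⇒1+≤ (λ p → stuck (x , φx , p)))) (lemma (D x) (laplacian φ x))
        where
        lemma : ∀ d l → d - - l - 0ℤ ≡ d + 1ℤ - (- l + 1ℤ)
        lemma = solve-∀
      legal-at x x≢q (inj₂ φx) = linear (eff x x≢q ⊕ laplacian-maximum (λ y → subst (φ y ≤_) (sym φx) (indicator-≤1 ind y)))
        (lemma (D x) (laplacian φ x))
        where
        lemma : ∀ d l → d - - l - 0ℤ ≡ d + l
        lemma = solve-∀
    -- Everything is burnt: the invariant reads deg D + #V ≤ #E, against the assumed degree.
    ... | no _ | no none = absurd-gap (gap large ⊕ gap inv′) (lemma (deg D) (+ #V) (+ #E))
      where
      all-burnt : ∀ x → φ x ≡ 1ℤ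
      all-burnt x with ind x
      ... | inj₁ p = contradiction (x , p) none
      ... | inj₂ p = p
      inv′ : deg D + + #V ≤ + #E
      inv′ = subst₂ _≤_
        (trans (sum-cong-≗ (λ x → trans (cong (_* (D x + 1ℤ)) (all-burnt x)) (ℤ.*-identityˡ (D x + 1ℤ))))
          (trans (∑-distrib-+ D (λ _ → 1ℤ)) (cong (λ t → deg D + t) (sum-one #V))))
        (trans (sum-cong-≗ (λ e → cong₂ _*_ (all-burnt (src e)) (all-burnt (tgt e)))) (sum-one #E))
        inv
      lemma : ∀ d v e → d + v - (e + 1ℤ) + (e - (d + v)) ≡ -1ℤ
      lemma = solve-∀
    ... | yes (z , φz , burnable) | _ = next m size
      where
      φ′ : Vertex → ℤ
      φ′ x = φ x + ⟨ z ⟩ x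
      ind′ : IsIndicator φ′
      ind′ x with x ≟ z
      ... | yes refl = inj₂ (cong (_+ 1ℤ) φz)
      ... | no _     with ind x
      ...   | inj₁ p = inj₁ (trans (ℤ.+-identityʳ (φ x)) p)
      ...   | inj₂ p = inj₂ (trans (ℤ.+-identityʳ (φ x)) p)
      φ′q : φ′ q ≡ 1ℤ
      φ′q with q ≟ z
      ... | yes refl with () ← trans (sym φz) φq
      ... | no _     = trans (ℤ.+-identityʳ (φ q)) φq
      unburnt′ : sum (λ x → 1ℤ - φ′ x) ≡ sum (λ x → 1ℤ - φ x) - 1ℤ
      unburnt′ = trans (sum-cong-≗ (λ x → lemma (φ x) (⟨ z ⟩ x)))
        (trans (sum-linear -1ℤ ⟨ z ⟩ (λ x → 1ℤ - φ x))
          (trans (cong (λ t → -1ℤ * t + sum (λ x → 1ℤ - φ x)) (deg-⟨⟩ z)) (ℤ.+-comm -1ℤ (sum (λ x → 1ℤ - φ x)))))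
        where
        lemma : ∀ a b → 1ℤ - (a + b) ≡ -1ℤ * b + (1ℤ - a)
        lemma = solve-∀
      weight′ : sum (λ x → φ′ x * (D x + 1ℤ)) ≡ sum (λ x → φ x * (D x + 1ℤ)) + (D z + 1ℤ)
      weight′ = trans (sum-cong-≗ (λ x → lemma (φ x) (⟨ z ⟩ x) (D x + 1ℤ)))
        (trans (∑-distrib-+ (λ x → φ x * (D x + 1ℤ)) (λ x → (D x + 1ℤ) * ⟨ z ⟩ x))
          (cong (λ t → sum (λ x → φ x * (D x + 1ℤ)) + t) (sum-*-δ (λ x → D x + 1ℤ) z)))
        where
        lemma : ∀ a b c → (a + b) * c ≡ a * c + c * b
        lemma = solve-∀
      -- The edges joining `z` to the burnt set are gained. The terms dropped in the estimate are
      -- products of nonnegative factors.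
      edges′ : sum (λ e → φ (src e) * φ (tgt e)) + - laplacian φ z ≤ sum (λ e → φ′ (src e) * φ′ (tgt e))
      edges′ = subst (_≤ sum (λ e → φ′ (src e) * φ′ (tgt e)))
        (trans (sum-linear -1ℤ (λ e → (φ (src e) - φ (tgt e)) * boundary e z) (λ e → φ (src e) * φ (tgt e)))
          (flip (laplacian φ z) (sum (λ e → φ (src e) * φ (tgt e)))))
        (sum-mono {#E} (λ e → linear
          (*-nonneg (indicator-≥0 ind (src e)) (0≤δ (src e ≟ z)) ⊕ *-nonneg (indicator-≥0 ind (tgt e)) (0≤δ (tgt e ≟ z))
            ⊕ *-nonneg (0≤δ (src e ≟ z)) (0≤δ (tgt e ≟ z)))
          (expand (φ (src e)) (φ (tgt e)) (δ (src e ≟ z)) (δ (tgt e ≟ z)))))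
        where
        flip : ∀ l s → -1ℤ * l + s ≡ s + - l
        flip = solve-∀
        expand : ∀ s t a b → (s + a) * (t + b) - (-1ℤ * ((s - t) * (a - b)) + s * t) ≡ s * a + t * b + a * b
        expand = solve-∀
      inv′ : sum (λ x → φ′ x * (D x + 1ℤ)) ≤ sum (λ e → φ′ (src e) * φ′ (tgt e))
      inv′ = subst (_≤ sum (λ e → φ′ (src e) * φ′ (tgt e))) (sym weight′) (ℤ.≤-trans (ℤ.+-mono-≤ inv burnable) edges′)
      -- `m` bounds the number of unburnt vertices; it cannot be zero while `z` is unburnt.
      next : ∀ m → sum (λ x → 1ℤ - φ x) ≤ + m → LegalFiring D
      next zero    size = absurd-gap (gap (ℤ.≤-trans (subst (_≤ sum (λ x → 1ℤ - φ x)) (cong (λ t → 1ℤ - t) φz)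
                            (term≤sum {f = λ x → 1ℤ - φ x} (λ x → gap (indicator-≤1 ind x)) z)) size)) refl
      next (suc m) size = burn D eff large m φ′ ind′ φ′q
        (linear (gap size) (trans (cong (λ t → + m - t) unburnt′) (lemma (+ m) (sum (λ x → 1ℤ - φ x))))) inv′
        where
        lemma : ∀ m s → m - (s - 1ℤ) ≡ 1ℤ + m - s
        lemma = solve-∀

    -- The fire starts at `q` alone. The debt there, `D q + 1ℤ ≤ 0ℤ`, gives the invariant at the
    -- start.
    legal-firing : ∀ D → EffectiveOff D → D q < 0ℤ → genus ≤ deg D → LegalFiring D
    legal-firing D eff Dq<0 large = burn D eff
      (linear (gap large) (degree (deg D) (+ #E) (+ #V))) #V ⟨ q ⟩ indicator (at-q refl)
      (subst (_≤ + #V) (sym unburnt) (linear (0≤+ 1) (one (+ #V))))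
      (ℤ.≤-trans (subst (_≤ 0ℤ) (sym weight) (subst (_≤ 0ℤ) (ℤ.+-comm 1ℤ (D q)) (ℤ.i<j⇒suc[i]≤j Dq<0)))
        (sum-nonneg (λ e → *-nonneg (0≤δ (src e ≟ q)) (0≤δ (tgt e ≟ q)))))
      where
      degree : ∀ d e v → d + v - (e + 1ℤ) ≡ d - (e - v + 1ℤ)
      degree = solve-∀
      one : ∀ v → v - (v - 1ℤ) ≡ 1ℤ
      one = solve-∀
      at-q : ∀ {x} → x ≡ q → ⟨ q ⟩ x ≡ 1ℤ
      at-q {x} p with x ≟ q
      ... | yes _ = refl
      ... | no ¬p = contradiction p ¬p
      indicator : IsIndicator ⟨ q ⟩
      indicator x with x ≟ q
      ... | yes _ = inj₂ refl
      ... | no _  = inj₁ refl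
      unburnt : sum (λ x → 1ℤ - ⟨ q ⟩ x) ≡ + #V - 1ℤ
      unburnt = trans (sum-cong-≗ (λ x → flip (⟨ q ⟩ x)))
        (trans (sum-linear -1ℤ ⟨ q ⟩ (λ _ → 1ℤ))
          (trans (cong₂ (λ a b → -1ℤ * a + b) (deg-⟨⟩ q) (sum-one #V)) (ℤ.+-comm -1ℤ (+ #V))))
        where
        flip : ∀ a → 1ℤ - a ≡ -1ℤ * a + 1ℤ
        flip = solve-∀
      weight : sum (λ x → ⟨ q ⟩ x * (D x + 1ℤ)) ≡ D q + 1ℤ
      weight = trans (sum-cong-≗ (λ x → ℤ.*-comm (⟨ q ⟩ x) (D x + 1ℤ))) (sum-*-δ (λ x → D x + 1ℤ) q)

    -- Termination of the reduction

    module _ {h : Vertex → ℤ} (pot : Potential h) where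

      weighted : Divisor → ℤ
      weighted D = sum (λ x → h x * D x)

      weighted-nonneg : ∀ D → EffectiveOff D → 0ℤ ≤ weighted D
      weighted-nonneg D eff = sum-nonneg term
        where
        term : ∀ x → 0ℤ ≤ h x * D x
        term x with x ≟ q
        ... | yes refl = ℤ.≤-reflexive (sym (trans (cong (_* D q) (pot .superharmonic .at-base)) (ℤ.*-zeroˡ (D q))))
        ... | no x≢q   = *-nonneg (ℤ.≤-trans (0≤+ 1) (pot .superharmonic .off-base x x≢q)) (eff x x≢q)

      -- By self-adjointness the loss is the pairing of the script with `laplacian h`. The script is
      -- nonnegative, vanishes at `q` and is positive somewhere, hence at a vertex where
      -- `laplacian h` is at least 1.
      weighted-drops : ∀ D (l : LegalFiring D) → weighted (D -ᵈ laplacian (script l)) + 1ℤ ≤ weighted D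
      weighted-drops D l = linear (gap fired-term)
        (trans (cong (λ t → weighted D - (t + 1ℤ)) split) (lemma (weighted D) (sum (λ x → f x * laplacian h x))))
        where
        f : Vertex → ℤ
        f = script l
        lemma : ∀ w s → w - (-1ℤ * s + w + 1ℤ) ≡ s - 1ℤ
        lemma = solve-∀
        distrib : ∀ h d l → h * (d - l) ≡ -1ℤ * (h * l) + h * d
        distrib = solve-∀
        split : weighted (D -ᵈ laplacian f) ≡ -1ℤ * sum (λ x → f x * laplacian h x) + weighted D
        split = trans (sum-cong-≗ (λ x → distrib (h x) (D x) (laplacian f x)))
          (trans (sum-linear -1ℤ (λ x → h x * laplacian f x) (λ x → h x * D x))
            (cong (λ t → -1ℤ * t + weighted D) (green-sym f h)))
        term : ∀ x → 0ℤ ≤ f x * laplacian h x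
        term x with x ≟ q
        ... | yes refl = ℤ.≤-reflexive (sym (trans (cong (_* laplacian h q) (fixes-base l)) (ℤ.*-zeroˡ (laplacian h q))))
        ... | no x≢q   = *-nonneg (nonneg l x) (ℤ.≤-trans (0≤+ 1) (pot .strict x x≢q))
        fired-term : 1ℤ ≤ sum (λ x → f x * laplacian h x)
        fired-term = ℤ.≤-trans
          (linear (*-nonneg (gap 1≤fz) (ℤ.≤-trans (0≤+ 1) big) ⊕ gap big) (expand (f z) (laplacian h z)))
          (term≤sum term z)
          where
          z : Vertex
          z = proj₁ (fired l)
          1≤fz : 1ℤ ≤ f z
          1≤fz = proj₂ (fired l)
          big : 1ℤ ≤ laplacian h z
          big = pot .strict z (λ z≡q → absurd-gap (gap (subst (1ℤ ≤_) (trans (cong f z≡q) (fixes-base l)) 1≤fz)) refl)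
          expand : ∀ a b → a * b - 1ℤ ≡ (a - 1ℤ) * b + (b - 1ℤ)
          expand = solve-∀

      -- Legal firings are repeated until `q` is out of debt; `n` bounds the weight, which stays
      -- nonnegative and drops each time.
      reduce : ∀ n D → EffectiveOff D → genus ≤ deg D → weighted D ≤ + n → NonEmpty∣ D ∣
      reduce n D eff large size with 0ℤ ℤ.≤? D q
      ... | yes 0≤Dq = D , effective , ε
        where
        effective : Effective D
        effective x with x ≟ q
        ... | yes refl = 0≤Dq
        ... | no x≢q   = eff x x≢q
      ... | no Dq≱0 = fire-on n size (legal-firing D eff (ℤ.≰⇒> Dq≱0) large)
        where
        fire-on : ∀ n → weighted D ≤ + n → LegalFiring D → NonEmpty∣ D ∣
        fire-on zero size l = absurd-gap
          (gap (weighted-drops D l) ⊕ gap size ⊕ weighted-nonneg _ (legal l))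
          (lemma (weighted D) (weighted (D -ᵈ laplacian (script l))))
          where
          lemma : ∀ a b → a - (b + 1ℤ) + (0ℤ - a) + b ≡ -1ℤ
          lemma = solve-∀
        fire-on (suc n) size l = nonEmpty-resp-∼ (∼-sym D∼D′) (reduce n D′ (legal l) (subst (genus ≤_) (deg-∼ D∼D′) large)
            (linear (gap (weighted-drops D l) ⊕ gap size) (lemma (weighted D) (weighted D′) (+ n))))
          where
          D′ : Divisor
          D′ = D -ᵈ laplacian (script l)
          D∼D′ : D ∼ D′
          D∼D′ = script⇒∼ (script l , λ _ → refl)
          lemma : ∀ a b n → n - b ≡ a - (b + 1ℤ) + (1ℤ + n - a)
          lemma = solve-∀

  genus≤deg⇒nonEmpty : ∀ D → genus ≤ deg D → NonEmpty∣ D ∣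
  genus≤deg⇒nonEmpty D large = nonEmpty-resp-∼ (∼-sym D∼D′)
    (reduce q pot ∣ weighted q pot D′ ∣ D′ eff (subst (genus ≤_) (deg-∼ D∼D′) large)
      (ℤ.≤-reflexive (sym (ℤ.0≤i⇒+∣i∣≡i (weighted-nonneg q pot D′ eff)))))
    where
    q : Vertex
    q = baseVertex
    pot : Potential q (proj₁ (potential-exists q))
    pot = proj₂ (potential-exists q)
    D′ : Divisor
    D′ = proj₁ (effectiveOff-representative q pot D)
    D∼D′ : D ∼ D′
    D∼D′ = proj₁ (proj₂ (effectiveOff-representative q pot D))
    eff : EffectiveOff q D′
    eff = proj₂ (proj₂ (effectiveOff-representative q pot D))

-- Rank

module _ (G : Graph) where
  open Graph G
  open ChipFiring G

  +ᵈ-cong-∼ : ∀ {D D′} E → D ∼ D′ → D +ᵈ E ∼ D′ +ᵈ E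
  +ᵈ-cong-∼ {D} {D′} E D∼D′ = script⇒∼ (f , λ x → trans (cong (_+ E x) (p x)) (lemma (D x) (laplacian f x) (E x)))
    where
    f : Vertex → ℤ
    f = proj₁ (∼⇒script D∼D′)
    p : D′ ≗ D -ᵈ laplacian f
    p = proj₂ (∼⇒script D∼D′)
    lemma : ∀ d l e → d - l + e ≡ d + e - l
    lemma = solve-∀

  ·ᵈ-cong-∼ : ∀ {D D′} c → D ∼ D′ → c ·ᵈ D ∼ c ·ᵈ D′
  ·ᵈ-cong-∼ {D} {D′} c D∼D′ = script⇒∼ ((λ y → c * f y) , λ x → trans (cong (c *_) (p x))
      (trans (ℤ.*-distribˡ-+ c (D x) (- laplacian f x))
        (cong (λ z → c * D x + z) (trans (sym (ℤ.neg-distribʳ-* c (laplacian f x))) (cong -_ (sym (laplacian-· G c f x)))))))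
    where
    f : Vertex → ℤ
    f = proj₁ (∼⇒script D∼D′)
    p : D′ ≗ D -ᵈ laplacian f
    p = proj₂ (∼⇒script D∼D′)

  nonEmpty-+ : ∀ {D E} → NonEmpty∣ D ∣ → Effective E → NonEmpty∣ D +ᵈ E ∣
  nonEmpty-+ {D} {E} (F , effF , D∼F) effE = F +ᵈ E , (λ x → effF x ⊕ effE x) , +ᵈ-cong-∼ E D∼F

  nonEmpty⇒0≤deg : ∀ {D} → NonEmpty∣ D ∣ → 0ℤ ≤ deg D
  nonEmpty⇒0≤deg (E , effE , D∼E) = subst (0ℤ ≤_) (sym (deg-∼ D∼E)) (sum-nonneg effE)

  effective-deg0 : ∀ {E} → Effective E → deg E ≡ 0ℤ → E ≗ 0ᵈ
  effective-deg0 {E} eff deg≡0 x = ℤ.≤-antisym (subst (E x ≤_) deg≡0 (term≤sum eff x)) (eff x)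

  nonEmpty-deg0 : ∀ {D} → NonEmpty∣ D ∣ → deg D ≡ 0ℤ → D ∼ 0ᵈ
  nonEmpty-deg0 (E , effE , D∼E) deg≡0 = D∼E ◅◅ ≗⇒∼ (effective-deg0 effE (trans (sym (deg-∼ D∼E)) deg≡0))

  effective-⟨⟩ : ∀ w → Effective ⟨ w ⟩
  effective-⟨⟩ w x = 0≤δ (x ≟ w)

  effective-deg1 : ∀ {E} → Effective E → deg E ≡ 1ℤ → ∃[ w ] E ≗ ⟨ w ⟩
  effective-deg1 {E} eff deg≡1 with any? (λ w → 1ℤ ℤ.≤? E w)
  ... | no none = absurd-gap (gap (ℤ.≤-trans (ℤ.≤-reflexive (sym deg≡1)) (subst (sum E ≤_) (sum-replicate-zero #V)
                    (sum-mono {g = λ _ → 0ℤ} (λ w → nonpos w (λ p → none (w , p))))))) refl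
    where
    nonpos : ∀ w → ¬ 1ℤ ≤ E w → E w ≤ 0ℤ
    nonpos w p = linear (gap (≰⇒1+≤ p)) (lemma (E w))
      where
      lemma : ∀ e → 0ℤ - e ≡ 1ℤ - (e + 1ℤ)
      lemma = solve-∀
  ... | yes (w , 1≤Ew) = w , λ x → trans (lemma (E x) (⟨ w ⟩ x)) (trans (cong (_+ ⟨ w ⟩ x)
          (effective-deg0 rest (trans (deg-- E ⟨ w ⟩) (cong₂ _-_ deg≡1 (deg-⟨⟩ w))) x)) (ℤ.+-identityˡ (⟨ w ⟩ x)))
    where
    rest : Effective (E -ᵈ ⟨ w ⟩)
    rest x with x ≟ w
    ... | yes refl = gap 1≤Ew
    ... | no _     = subst (0ℤ ≤_) (sym (ℤ.+-identityʳ (E x))) (eff x)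
    lemma : ∀ e d → e ≡ e - d + d
    lemma = solve-∀

  nonEmpty-deg1 : ∀ {D} → NonEmpty∣ D ∣ → deg D ≡ 1ℤ → ∃[ w ] D ∼ ⟨ w ⟩
  nonEmpty-deg1 (E , effE , D∼E) deg≡1 = proj₁ point , D∼E ◅◅ ≗⇒∼ (proj₂ point)
    where
    point : ∃[ w ] E ≗ ⟨ w ⟩
    point = effective-deg1 effE (trans (sym (deg-∼ D∼E)) deg≡1)

  module _ (n : ℕ) where
    multiple : Vertex → Divisor
    multiple w = + n ·ᵈ ⟨ w ⟩

    effective-multiple : ∀ w → Effective (multiple w)
    effective-multiple w x = *-nonneg (0≤+ n) (effective-⟨⟩ w x)

    deg-multiple : ∀ w → deg (multiple w) ≡ + n
    deg-multiple w = trans (deg-· (+ n) ⟨ w ⟩) (trans (cong (+ n *_) (deg-⟨⟩ w)) (ℤ.*-identityʳ (+ n)))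

  rankAtLeast-resp-∼ : ∀ {D D′ r} → D ∼ D′ → RankAtLeast D r → RankAtLeast D′ r
  rankAtLeast-resp-∼ D∼D′ p E eff degE = nonEmpty-resp-∼ G (+ᵈ-cong-∼ (λ x → - E x) D∼D′) (p E eff degE)

  rankAtLeast⇒nonEmpty : ∀ {D r} → RankAtLeast D r → NonEmpty∣ D ∣
  rankAtLeast⇒nonEmpty {D} {r} p = nonEmpty-resp-≗ (λ x → lemma (D x) (multiple r baseVertex x))
    (nonEmpty-+ (p _ (effective-multiple r baseVertex) (deg-multiple r baseVertex)) (effective-multiple r baseVertex))
    where
    lemma : ∀ d e → d - e + e ≡ d
    lemma = solve-∀

  rankAtLeast-mono : ∀ {D r s} → s ℕ.≤ r → RankAtLeast D r → RankAtLeast D s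
  rankAtLeast-mono {D} {r} {s} s≤r p E eff degE = rankAtLeast⇒nonEmpty {D -ᵈ E} {r ℕ.∸ s} λ F effF degF →
    nonEmpty-resp-≗ (λ x → lemma (D x) (E x) (F x))
      (p (E +ᵈ F) (λ x → eff x ⊕ effF x) (trans (deg-+ E F)
        (trans (cong₂ _+_ degE degF) (cong +_ (ℕ.m+[n∸m]≡n s≤r)))))
    where
    lemma : ∀ d e f → d - (e + f) ≡ d - e - f
    lemma = solve-∀

  -1≤rank : ∀ D → -1ℤ ≤ rank D
  -1≤rank D with rank D | rank-isRank D
  ... | _ | rank-empty _          = ℤ.≤-refl
  ... | _ | rank-nonempty _ _ _ _ = -≤+

  ≤rank⇒rankAtLeast : ∀ {D s} → + s ≤ rank D → RankAtLeast D s
  ≤rank⇒rankAtLeast {D} {s} s≤r with rank D | rank-isRank D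
  ... | _ | rank-empty _          = contradiction s≤r λ ()
  ... | _ | rank-nonempty r _ p _ = rankAtLeast-mono {D} (ℤ.drop‿+≤+ s≤r) p

  rankAtLeast⇒≤rank : ∀ {D s} → RankAtLeast D s → + s ≤ rank D
  rankAtLeast⇒≤rank {D} {s} p with rank D | rank-isRank D
  ... | _ | rank-empty ¬ne          = contradiction (rankAtLeast⇒nonEmpty p) ¬ne
  ... | _ | rank-nonempty r _ _ max = +≤+ (max s p)

  0≤rank⇒nonEmpty : ∀ {D} → 0ℤ ≤ rank D → NonEmpty∣ D ∣
  0≤rank⇒nonEmpty 0≤r = rankAtLeast⇒nonEmpty {r = 0} (≤rank⇒rankAtLeast 0≤r)

  nonEmpty⇒0≤rank : ∀ {D} → NonEmpty∣ D ∣ → 0ℤ ≤ rank D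
  nonEmpty⇒0≤rank {D} ne = rankAtLeast⇒≤rank {s = 0} λ E eff degE →
    nonEmpty-resp-≗ (λ x → sym (trans (cong (λ z → D x - z) (effective-deg0 eff degE x)) (ℤ.+-identityʳ (D x)))) ne

  rank-cong-≤ : ∀ {D D′} → D ∼ D′ → rank D ≤ rank D′
  rank-cong-≤ {D} {D′} D∼D′ with rank D | rank-isRank D
  ... | _ | rank-empty _          = -1≤rank D′
  ... | _ | rank-nonempty r _ p _ = rankAtLeast⇒≤rank (rankAtLeast-resp-∼ D∼D′ p)

  rank-cong : ∀ {D D′} → D ∼ D′ → rank D ≡ rank D′
  rank-cong D∼D′ = ℤ.≤-antisym (rank-cong-≤ D∼D′) (rank-cong-≤ (∼-sym D∼D′))

  rank-cong-≗ : ∀ {D D′} → D ≗ D′ → rank D ≡ rank D′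
  rank-cong-≗ D≗D′ = rank-cong (≗⇒∼ D≗D′)

  rank-negative : ∀ {D} → deg D < 0ℤ → rank D ≡ -1ℤ
  rank-negative {D} deg<0 with rank D | rank-isRank D
  ... | _ | rank-empty _           = refl
  ... | _ | rank-nonempty _ ne _ _ = contradiction (nonEmpty⇒0≤deg ne) (ℤ.<⇒≱ deg<0)

  -- Removing any effective divisor of degree deg D - g leaves degree g, which is enough to be
  -- effective.
  deg-genus≤rank : ∀ D → deg D - genus ≤ rank D
  deg-genus≤rank D = bound (deg D - genus) refl
    where
    lemma : ∀ d g e → d - e - g ≡ d - g - e
    lemma = solve-∀
    bound : ∀ i → deg D - genus ≡ i → i ≤ rank D
    bound -[1+ n ] _  = ℤ.≤-trans (-≤- z≤n) (-1≤rank D)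
    bound (+ s)    eq = rankAtLeast⇒≤rank λ E eff degE → genus≤deg⇒nonEmpty G (D -ᵈ E)
      (linear (0≤+ 0) (trans (cong (_- genus) (deg-- D E)) (trans (lemma (deg D) genus (deg E))
        (trans (cong₂ _-_ eq degE) (ℤ.+-inverseʳ (+ s))))))

  -- As r(A) = 0, some A - E of degree g-1 = 1 is not effective; subtracting
  -- a representative of D - (A - E) from D shows that r(D) < deg D - 1.
  rank≤deg-2 : ∀ {A} → genus ≡ + 2 → deg A ≡ + 2 → rank A ≡ 0ℤ → ∀ D → + 3 ≤ deg D → rank D ≤ deg D - + 2
  rank≤deg-2 {A} g≡2 degA rankA D 3≤deg with rank D ℤ.≤? deg D - + 2
  ... | yes p = p
  ... | no ¬p = absurd-gap (gap (subst (1ℤ ≤_) rankA (rankAtLeast⇒≤rank {A} {1} A≥1))) refl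
    where
    s : ℕ
    s = ∣ deg D - 1ℤ ∣
    s≡ : + s ≡ deg D - 1ℤ
    s≡ = ℤ.0≤i⇒+∣i∣≡i (ℤ.≤-trans (0≤+ 2) (linear (gap 3≤deg) (lemma (deg D))))
      where
      lemma : ∀ d → d - 1ℤ - + 2 ≡ d - + 3
      lemma = solve-∀
    D≥s : RankAtLeast D s
    D≥s = ≤rank⇒rankAtLeast (linear (gap (≰⇒1+≤ ¬p)) (trans (cong (λ z → rank D - z) s≡) (lemma (rank D) (deg D))))
      where
      lemma : ∀ r d → r - (d - 1ℤ) ≡ r - (d - + 2 + 1ℤ)
      lemma = solve-∀
    A≥1 : RankAtLeast A 1
    A≥1 E effE degE = nonEmpty-resp-∼ G D-F∼A-E (D≥s F effF degF)
      where
      B : Divisor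
      B = D -ᵈ (A -ᵈ E)
      degB : deg B ≡ deg D - 1ℤ
      degB = trans (deg-- D (A -ᵈ E)) (cong (λ z → deg D - z) (trans (deg-- A E) (cong₂ _-_ degA degE)))
      neB : NonEmpty∣ B ∣
      neB = genus≤deg⇒nonEmpty G B (subst₂ _≤_ (sym g≡2) (sym degB) (linear (gap 3≤deg) (lemma (deg D))))
        where
        lemma : ∀ d → d - 1ℤ - + 2 ≡ d - + 3
        lemma = solve-∀
      F : Divisor
      F = proj₁ neB
      effF : Effective F
      effF = proj₁ (proj₂ neB)
      B∼F : B ∼ F
      B∼F = proj₂ (proj₂ neB)
      degF : deg F ≡ + s
      degF = trans (sym (deg-∼ B∼F)) (trans degB (sym s≡))
      lemma₁ : ∀ d f a e → f + (d - f - (d - (a - e))) ≡ a - e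
      lemma₁ = solve-∀
      lemma₂ : ∀ d f a e → d - (a - e) + (d - f - (d - (a - e))) ≡ d - f
      lemma₂ = solve-∀
      D-F∼A-E : D -ᵈ F ∼ A -ᵈ E
      D-F∼A-E = ≗⇒∼ (λ x → sym (lemma₂ (D x) (F x) (A x) (E x)))
        ◅◅ +ᵈ-cong-∼ (λ x → D x - F x - B x) B∼F
        ◅◅ ≗⇒∼ (λ x → lemma₁ (D x) (F x) (A x) (E x))

-- Step functions and counting on ℤ

δ-yes : ∀ {p} {P : Set p} (P? : Dec P) → P → δ P? ≡ 1ℤ
δ-yes (yes _) _ = refl
δ-yes (no ¬p) p = contradiction p ¬p

δ-no : ∀ {p} {P : Set p} (P? : Dec P) → ¬ P → δ P? ≡ 0ℤ
δ-no (yes p) ¬p = contradiction p ¬p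
δ-no (no _)  _  = refl

δ≡1⇒ : ∀ {p} {P : Set p} (P? : Dec P) → δ P? ≡ 1ℤ → P
δ≡1⇒ (yes p) _ = p

≤-difference : ∀ {i j} → i ≤ j → ∃[ n ] j ≡ i + + n
≤-difference {i} {j} p = ∣ j - i ∣ , trans (lemma i j) (cong (λ z → i + z) (sym (ℤ.0≤i⇒+∣i∣≡i (gap p))))
  where
  lemma : ∀ i j → j ≡ i + (j - i)
  lemma = solve-∀

≤⇒<∨≡ : ∀ {i j} → i ≤ j → i + 1ℤ ≤ j ⊎ i ≡ j
≤⇒<∨≡ {i} {j} p with i ℤ.≟ j
... | yes e = inj₂ e
... | no ne = inj₁ (<⇒1+≤ (ℤ.≤∧≢⇒< p ne))

step-monotone : (F : ℤ → ℤ) → (∀ i → F (i - 1ℤ) ≤ F i) → ∀ {i j} → i ≤ j → F i ≤ F j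
step-monotone F mono {i} i≤j with ≤-difference i≤j
... | n , refl = climb n
  where
  climb : ∀ n → F i ≤ F (i + + n)
  climb zero    = ℤ.≤-reflexive (cong F (sym (ℤ.+-identityʳ i)))
  climb (suc n) = ℤ.≤-trans (climb n) (subst (λ z → F z ≤ F (i + + suc n)) (lemma i (+ n)) (mono (i + + suc n)))
    where
    lemma : ∀ i n → i + (1ℤ + n) - 1ℤ ≡ i + n
    lemma = solve-∀

δ-≤-step : ∀ t i → δ (t ℤ.≤? i) - δ (t ℤ.≤? i - 1ℤ) ≡ δ (t ℤ.≟ i)
δ-≤-step t i with ℤ.<-cmp t i
... | tri< t<i t≢i _ = trans (cong₂ _-_ (δ-yes (t ℤ.≤? i) (ℤ.<⇒≤ t<i))
                         (δ-yes (t ℤ.≤? i - 1ℤ) (linear (gap (<⇒1+≤ t<i)) (lemma t i)))) (sym (δ-no (t ℤ.≟ i) t≢i))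
  where
  lemma : ∀ t i → i - 1ℤ - t ≡ i - (t + 1ℤ)
  lemma = solve-∀
... | tri≈ _ refl _ = trans (cong₂ _-_ (δ-yes (t ℤ.≤? t) ℤ.≤-refl)
                        (δ-no (t ℤ.≤? t - 1ℤ) (λ p → absurd-gap (gap p) (lemma t)))) (sym (δ-yes (t ℤ.≟ t) refl))
  where
  lemma : ∀ t → t - 1ℤ - t ≡ -1ℤ
  lemma = solve-∀
... | tri> _ t≢i i<t = trans (cong₂ _-_ (δ-no (t ℤ.≤? i) (ℤ.<⇒≱ i<t))
                         (δ-no (t ℤ.≤? i - 1ℤ) (λ p → absurd-gap (gap p ⊕ gap (<⇒1+≤ i<t)) (lemma t i)))) (sym (δ-no (t ℤ.≟ i) t≢i))
  where
  lemma : ∀ t i → i - 1ℤ - t + (t - (i + 1ℤ)) ≡ - + 2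
  lemma = solve-∀

-- Meant for the difference of two neighbouring rows of ranks; the jump `t` found by the search
-- becomes the value of the permutation on that row.
step-function : (F : ℤ → ℤ) → (∀ i → F (i - 1ℤ) ≤ F i) → ∀ lo hi →
                (∀ i → i ≤ lo → F i ≡ 0ℤ) → (∀ i → hi ≤ i → F i ≡ 1ℤ) →
                ∃[ t ] ∀ i → F i ≡ δ (t ℤ.≤? i)
step-function F mono lo hi low high with ≤-difference {lo} {hi} lo≤hi
  where
  lo≤hi : lo ≤ hi
  lo≤hi with lo ℤ.≤? hi
  ... | yes p = p
  ... | no ¬p with () ← trans (sym (low lo ℤ.≤-refl)) (high lo (ℤ.<⇒≤ (ℤ.≰⇒> ¬p)))
... | n , refl = search n lo (low lo ℤ.≤-refl) (high _ ℤ.≤-refl)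
  where
  bounds : ∀ i → 0ℤ ≤ F i × F i ≤ 1ℤ
  bounds i = lower , upper
    where
    lower : 0ℤ ≤ F i
    lower with i ℤ.≤? lo
    ... | yes p = ℤ.≤-reflexive (sym (low i p))
    ... | no ¬p = subst (_≤ F i) (low lo ℤ.≤-refl) (step-monotone F mono (ℤ.<⇒≤ (ℤ.≰⇒> ¬p)))
    upper : F i ≤ 1ℤ
    upper with hi ℤ.≤? i
    ... | yes p = ℤ.≤-reflexive (high i p)
    ... | no ¬p = subst (F i ≤_) (high hi ℤ.≤-refl) (step-monotone F mono (ℤ.<⇒≤ (ℤ.≰⇒> ¬p)))
  search : ∀ n i → F i ≡ 0ℤ → F (i + + n) ≡ 1ℤ → ∃[ t ] ∀ j → F j ≡ δ (t ℤ.≤? j)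
  search zero i p q with () ← trans (sym p) (trans (cong F (sym (ℤ.+-identityʳ i))) q)
  search (suc n) i p q with 1ℤ ℤ.≤? F (i + 1ℤ)
  ... | no ¬r = search n (i + 1ℤ) (ℤ.≤-antisym (linear (gap (≰⇒1+≤ ¬r)) (lemma₁ (F (i + 1ℤ)))) (proj₁ (bounds (i + 1ℤ))))
                  (trans (cong F (ℤ.+-assoc i 1ℤ (+ n))) q)
    where
    lemma₁ : ∀ f → 0ℤ - f ≡ 1ℤ - (f + 1ℤ)
    lemma₁ = solve-∀
  ... | yes r = i + 1ℤ , value
    where
    value : ∀ j → F j ≡ δ (i + 1ℤ ℤ.≤? j)
    value j with i + 1ℤ ℤ.≤? j
    ... | yes le = ℤ.≤-antisym (proj₂ (bounds j)) (ℤ.≤-trans r (step-monotone F mono le))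
    ... | no ¬le = ℤ.≤-antisym (subst (F j ≤_) p (step-monotone F mono (linear (gap (≰⇒1+≤ ¬le)) (lemma₂ i j)))) (proj₁ (bounds j))
      where
      lemma₂ : ∀ i j → i - j ≡ i + 1ℤ - (j + 1ℤ)
      lemma₂ = solve-∀

-- F i is the number of i′ ≤ i that satisfy P.
record Counts (F : ℤ → ℤ) {P : ℤ → Set} (P? : ∀ i → Dec (P i)) : Set where
  field
    nonneg     : ∀ i → 0ℤ ≤ F i
    eventually : ∀ i → ∃[ n ] F (i - + n) ≡ 0ℤ
    step       : ∀ i → F i - F (i - 1ℤ) ≡ δ (P? i)

module Counting {F : ℤ → ℤ} {P : ℤ → Set} {P? : ∀ i → Dec (P i)} (c : Counts F P?) where
  open Counts c

  step-yes : ∀ {i} → P i → F i ≡ F (i - 1ℤ) + 1ℤ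
  step-yes {i} p = trans (lemma (F i) (F (i - 1ℤ))) (cong (λ z → F (i - 1ℤ) + z) (trans (step i) (δ-yes (P? i) p)))
    where
    lemma : ∀ a b → a ≡ b + (a - b)
    lemma = solve-∀

  step-no : ∀ {i} → ¬ P i → F i ≡ F (i - 1ℤ)
  step-no {i} p = ℤ.i-j≡0⇒i≡j (F i) (F (i - 1ℤ)) (trans (step i) (δ-no (P? i) p))

  monotone : ∀ {i j} → i ≤ j → F i ≤ F j
  monotone = step-monotone F λ i → linear (0≤δ (P? i)) (step i)

  occurs⇒positive : ∀ {i j} → j ≤ i → P j → 1ℤ ≤ F i
  occurs⇒positive {i} {j} j≤i p = ℤ.≤-trans
    (linear (nonneg (j - 1ℤ)) (trans (cong (_- 1ℤ) (step-yes p)) (lemma (F (j - 1ℤ))))) (monotone j≤i)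
    where
    lemma : ∀ a → a + 1ℤ - 1ℤ ≡ a
    lemma = solve-∀

  positive⇒occurs : ∀ {i} → 1ℤ ≤ F i → ∃[ j ] (j ≤ i × P j)
  positive⇒occurs {i} pos = descend (proj₁ (eventually i)) i pos (proj₂ (eventually i))
    where
    descend : ∀ n i → 1ℤ ≤ F i → F (i - + n) ≡ 0ℤ → ∃[ j ] (j ≤ i × P j)
    descend n i pos z with P? i
    descend n i pos z | yes p = i , ℤ.≤-refl , p
    descend zero i pos z | no ¬p = absurd-gap (gap (subst (1ℤ ≤_) (trans (cong F (sym (ℤ.+-identityʳ i))) z) pos)) refl
    descend (suc n) i pos z | no ¬p with descend n (i - 1ℤ) (subst (1ℤ ≤_) (step-no ¬p) pos)
                                           (trans (cong F (lemma i (+ n))) z)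
      where
      lemma : ∀ i n → i - 1ℤ - n ≡ i - (1ℤ + n)
      lemma = solve-∀
    ... | j , j≤i-1 , p = j , linear (gap j≤i-1 ⊕ 0≤+ 1) (lemma i j) , p
      where
      lemma : ∀ i j → i - j ≡ i - 1ℤ - j + 1ℤ
      lemma = solve-∀

  occurs-twice : ∀ {i j j′} → j′ ≤ i → j < j′ → P j → P j′ → + 2 ≤ F i
  occurs-twice {i} {j} {j′} j′≤i j<j′ p p′ = ℤ.≤-trans
    (linear (gap (occurs⇒positive (linear (gap (<⇒1+≤ j<j′)) (lemma₁ j j′)) p))
      (trans (cong (_- + 2) (step-yes p′)) (lemma₂ (F (j′ - 1ℤ))))) (monotone j′≤i)
    where
    lemma₁ : ∀ j j′ → j′ - 1ℤ - j ≡ j′ - (j + 1ℤ)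
    lemma₁ = solve-∀
    lemma₂ : ∀ a → a + 1ℤ - + 2 ≡ a - 1ℤ
    lemma₂ = solve-∀

  occurs-once : ∀ {i j j′} → F i ≤ 1ℤ → j ≤ i → j′ ≤ i → P j → P j′ → j ≡ j′
  occurs-once {i} {j} {j′} F≤1 j≤i j′≤i p p′ with ℤ.<-cmp j j′
  ... | tri≈ _ e _ = e
  ... | tri< l _ _ = absurd-gap (gap (ℤ.≤-trans (occurs-twice j′≤i l p p′) F≤1)) refl
  ... | tri> _ _ l = absurd-gap (gap (ℤ.≤-trans (occurs-twice j≤i l p′ p) F≤1)) refl

-- The lattice of twists

mixedDifference : (ℤ → ℤ → ℤ) → ℤ → ℤ → ℤ
mixedDifference R a i = R a i - R (a - 1ℤ) i - R a (i - 1ℤ) + R (a - 1ℤ) (i - 1ℤ)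

-- R a i plays the role of r(D + a u + i v), where D has degree d.
record RankLattice (d : ℤ) (R : ℤ → ℤ → ℤ) : Set where
  field
    negative    : ∀ a i → d + a + i < 0ℤ → R a i ≡ -1ℤ
    large       : ∀ a i → + 3 ≤ d + a + i → R a i ≡ d + a + i - + 2
    submodular  : ∀ a i → 0ℤ ≤ mixedDifference R a i

module _ {d R} (L : RankLattice d R) where
  open RankLattice L

  -- Exchanges the roles of the marked vertices, so that the row argument also treats columns and
  -- yields the inverse permutation.
  transpose : RankLattice d (λ a i → R i a)
  transpose = record
    { negative   = λ a i p → negative i a (subst (_< 0ℤ) (swap d a i) p)
    ; large      = λ a i p → trans (large i a (subst (+ 3 ≤_) (swap d a i) p)) (cong (_- + 2) (swap d i a))
    ; submodular = λ a i → subst (0ℤ ≤_) (exchange (R i a) (R (i - 1ℤ) a) (R i (a - 1ℤ)) (R (i - 1ℤ) (a - 1ℤ))) (submodular i a)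
    }
    where
    swap : ∀ d a i → d + a + i ≡ d + i + a
    swap = solve-∀
    exchange : ∀ r s t w → r - s - t + w ≡ r - t - s + w
    exchange = solve-∀

  abstract
    -- Submodularity says that this difference is nondecreasing in `a`. It is 0 where both ranks are
    -- -1 and 1 where both are deg - 2.
    row-step : ∀ i → ∃[ t ] ∀ a → R a i - R a (i - 1ℤ) ≡ δ (t ℤ.≤? a)
    row-step i = step-function (λ a → R a i - R a (i - 1ℤ))
      (λ a → linear (submodular a i) (regroup (R a i) (R (a - 1ℤ) i) (R a (i - 1ℤ)) (R (a - 1ℤ) (i - 1ℤ))))
      -- Up to the first bound the degree at `(a, i)` is negative; from the second on, even the
      -- smaller degree, at `(a, i - 1)`, is at least 3.
      (-1ℤ - d - i) (+ 4 - d - i)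
      (λ a p → cong₂ _-_
        (negative a i (1+≤⇒< (linear (gap p) (below d a i))))
        (negative a (i - 1ℤ) (1+≤⇒< (linear (gap p ⊕ 0≤+ 1) (below′ d a i)))))
      (λ a p → trans (cong₂ _-_
        (large a i (linear (gap p ⊕ 0≤+ 1) (above d a i)))
        (large a (i - 1ℤ) (linear (gap p) (above′ d a i)))) (unit d a i))
      where
      regroup : ∀ r s t w → r - t - (s - w) ≡ r - s - t + w
      regroup = solve-∀
      below : ∀ d a i → 0ℤ - (d + a + i + 1ℤ) ≡ -1ℤ - d - i - a
      below = solve-∀
      below′ : ∀ d a i → 0ℤ - (d + a + (i - 1ℤ) + 1ℤ) ≡ -1ℤ - d - i - a + 1ℤ
      below′ = solve-∀
      above : ∀ d a i → d + a + i - + 3 ≡ a - (+ 4 - d - i) + 1ℤ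
      above = solve-∀
      above′ : ∀ d a i → d + a + (i - 1ℤ) - + 3 ≡ a - (+ 4 - d - i)
      above′ = solve-∀
      unit : ∀ d a i → d + a + i - + 2 - (d + a + (i - 1ℤ) - + 2) ≡ 1ℤ
      unit = solve-∀

  mixedDifference-δ : ∀ t i → (∀ a → R a i - R a (i - 1ℤ) ≡ δ (t ℤ.≤? a)) → ∀ a → δ (t ℤ.≟ a) ≡ mixedDifference R a i
  mixedDifference-δ t i jump a = trans (sym (δ-≤-step t a)) (trans (cong₂ _-_ (sym (jump a)) (sym (jump (a - 1ℤ))))
    (regroup (R a i) (R (a - 1ℤ) i) (R a (i - 1ℤ)) (R (a - 1ℤ) (i - 1ℤ))))
    where
    regroup : ∀ r s t w → r - t - (s - w) ≡ r - s - t + w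
    regroup = solve-∀

  -- Allows the permutation to be any one that satisfies the defining identity: its value must be
  -- the jump found by `row-step`.
  permutation-jump : ∀ t i → (∀ a → δ (t ℤ.≟ a) ≡ mixedDifference R a i) → ∀ a → R a i - R a (i - 1ℤ) ≡ δ (t ℤ.≤? a)
  permutation-jump t i p a = subst (λ z → R a i - R a (i - 1ℤ) ≡ δ (z ℤ.≤? a)) (sym t≡s) (proj₂ (row-step i) a)
    where
    s : ℤ
    s = proj₁ (row-step i)
    t≡s : t ≡ s
    t≡s = δ≡1⇒ (t ℤ.≟ s) (trans (p s) (trans (sym (mixedDifference-δ s i (proj₂ (row-step i)) s)) (δ-yes (s ℤ.≟ s) refl)))

-- Collects what genus 2 and rigidity contribute. `R-deg0` holds as an effective class of degree 0
-- is trivial, so that adding u + v gives u + v itself; `R-deg1` as a divisor of degree 1 and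
-- positive rank would be equivalent to both u and v; `R-lower` by removing u.
record GenusTwoLattice (d : ℤ) (R : ℤ → ℤ → ℤ) : Set where
  field
    lattice     : RankLattice d R
    -1≤R        : ∀ a i → -1ℤ ≤ R a i
    deg-2≤R     : ∀ a i → d + a + i - + 2 ≤ R a i
    R-deg0      : ∀ a i → d + a + i ≡ 0ℤ → 0ℤ ≤ R a i → R (a + 1ℤ) (i + 1ℤ) ≤ 0ℤ
    R-deg1      : ∀ a i → d + a + i ≡ 1ℤ → R a i ≤ 0ℤ
    R-lower     : ∀ a i → 1ℤ ≤ R a i → 0ℤ ≤ R (a - 1ℤ) i
  open RankLattice lattice public

-- Boxes spanned by two points of the permutation

module Boxes {d R} (L : GenusTwoLattice d R) (τ : ℤ → ℤ)
             (jump : ∀ a i → R a i - R a (i - 1ℤ) ≡ δ (τ i ℤ.≤? a)) where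
  open GenusTwoLattice L

  below : ∀ a → Counts (λ i → R a i + 1ℤ) (λ i → τ i ℤ.≤? a)
  below a = record
    { nonneg     = λ i → linear (gap (-1≤R a i)) (shift (R a i))
    ; eventually = λ i → suc ∣ d + a + i ∣ , cong (_+ 1ℤ) (negative a _ (1+≤⇒<
                     (linear (0≤∣i∣+i (- (d + a + i))) (trans (far d a i (+ ∣ d + a + i ∣))
                       (cong (λ z → + z + - (d + a + i)) (sym (ℤ.∣-i∣≡∣i∣ (d + a + i))))))))
    ; step       = λ i → trans (cancel (R a i) (R a (i - 1ℤ))) (jump a i)
    }
    where
    shift : ∀ r → r + 1ℤ - 0ℤ ≡ r - -1ℤ
    shift = solve-∀
    far : ∀ d a i n → 0ℤ - (d + a + (i - (1ℤ + n)) + 1ℤ) ≡ n + - (d + a + i)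
    far = solve-∀
    cancel : ∀ r s → r + 1ℤ - (s + 1ℤ) ≡ r - s
    cancel = solve-∀

  -- The shift by deg - 2 turns the count below (a, i) into the count strictly
  -- above it; negating i makes that a count from below again.
  above : ∀ a → Counts (λ j → R a (- j) - (d + a + - j - + 2)) (λ j → a ℤ.<? τ (- j + 1ℤ))
  above a = record
    { nonneg     = λ j → gap (deg-2≤R a (- j))
    -- Going back in `j` raises the degree; from degree 3 on the rank is deg - 2 and nothing is left
    -- to count.
    ; eventually = λ j → 3 ℕ.+ ∣ d + a - j ∣ , far j
    ; step       = λ j → begin
        R a (- j) - (d + a + - j - + 2) - (R a (- (j - 1ℤ)) - (d + a + - (j - 1ℤ) - + 2))
          ≡⟨ cong (λ z → R a (- j) - (d + a + - j - + 2) - (R a z - (d + a + - (j - 1ℤ) - + 2))) (neg j) ⟩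
        R a (- j) - (d + a + - j - + 2) - (R a (- j + 1ℤ) - (d + a + - (j - 1ℤ) - + 2))
          ≡⟨ collect (R a (- j)) (R a (- j + 1ℤ)) d a j ⟩
        1ℤ - (R a (- j + 1ℤ) - R a (- j))
          ≡⟨ cong (λ z → 1ℤ - (R a (- j + 1ℤ) - R a z)) (back j) ⟩
        1ℤ - (R a (- j + 1ℤ) - R a (- j + 1ℤ - 1ℤ))
          ≡⟨ cong (λ z → 1ℤ - z) (jump a (- j + 1ℤ)) ⟩
        1ℤ - δ (τ (- j + 1ℤ) ℤ.≤? a)
          ≡⟨ complement (τ (- j + 1ℤ)) ⟩
        δ (a ℤ.<? τ (- j + 1ℤ)) ∎
    }
    where
    open ≡-Reasoning
    neg : ∀ j → - (j - 1ℤ) ≡ - j + 1ℤ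
    neg = solve-∀
    back : ∀ j → - j ≡ - j + 1ℤ - 1ℤ
    back = solve-∀
    collect : ∀ r s d a j → r - (d + a + - j - + 2) - (s - (d + a + - (j - 1ℤ) - + 2)) ≡ 1ℤ - (s - r)
    collect = solve-∀
    complement : ∀ t → 1ℤ - δ (t ℤ.≤? a) ≡ δ (a ℤ.<? t)
    complement t with t ℤ.≤? a
    ... | yes p = sym (δ-no (a ℤ.<? t) (ℤ.≤⇒≯ p))
    ... | no ¬p = sym (δ-yes (a ℤ.<? t) (ℤ.≰⇒> ¬p))
    far : ∀ j → R a (- (j - + (3 ℕ.+ ∣ d + a - j ∣))) - (d + a + - (j - + (3 ℕ.+ ∣ d + a - j ∣)) - + 2) ≡ 0ℤ
    far j = ℤ.i≡j⇒i-j≡0 (large a _ (linear (0≤∣i∣+i (d + a - j)) (expand d a j (+ ∣ d + a - j ∣))))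
      where
      expand : ∀ d a j n → d + a + - (j - (+ 3 + n)) - + 3 ≡ n + (d + a - j)
      expand = solve-∀

  below-positive : ∀ {a i i′} → i′ ≤ i → τ i′ ≤ a → 0ℤ ≤ R a i
  below-positive {a} {i} i′≤i p = linear (gap (Counting.occurs⇒positive (below a) i′≤i p)) (lemma (R a i))
    where
    lemma : ∀ r → r - 0ℤ ≡ r + 1ℤ - 1ℤ
    lemma = solve-∀

  below-occurs : ∀ {a i} → 0ℤ ≤ R a i → ∃[ i′ ] (i′ ≤ i × τ i′ ≤ a)
  below-occurs {a} {i} p = Counting.positive⇒occurs (below a) (linear p (lemma (R a i)))
    where
    lemma : ∀ r → r + 1ℤ - 1ℤ ≡ r
    lemma = solve-∀

  below-unique : ∀ {a i j j′} → R a i ≤ 0ℤ → j ≤ i → j′ ≤ i → τ j ≤ a → τ j′ ≤ a → j ≡ j′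
  below-unique {a} p = Counting.occurs-once (below a) (ℤ.+-monoˡ-≤ 1ℤ p)

  private
    flip-≤ : ∀ {i i′} → i < i′ → 1ℤ - i′ ≤ - i
    flip-≤ {i} {i′} p = linear (gap (<⇒1+≤ p)) (lemma i i′)
      where
      lemma : ∀ i i′ → - i - (1ℤ - i′) ≡ i′ - (i + 1ℤ)
      lemma = solve-∀

    flip-τ : ∀ {a i} → a < τ i → a < τ (- (1ℤ - i) + 1ℤ)
    flip-τ {a} {i} = subst (λ z → a < τ z) (lemma i)
      where
      lemma : ∀ i → i ≡ - (1ℤ - i) + 1ℤ
      lemma = solve-∀

    unflip : ∀ (Q : ℤ → Set) {i} → Q (- - i) → Q i
    unflip Q {i} = subst Q (ℤ.neg-involutive i)

  above-positive : ∀ {a i i′} → i < i′ → a < τ i′ → d + a + i - 1ℤ ≤ R a i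
  above-positive {a} {i} {i′} i<i′ p = unflip (λ z → d + a + z - 1ℤ ≤ R a z)
    (linear (gap (Counting.occurs⇒positive (above a) (flip-≤ i<i′) (flip-τ p))) (lemma (R a (- - i)) (d + a + - - i)))
    where
    lemma : ∀ r e → r - (e - 1ℤ) ≡ r - (e - + 2) - 1ℤ
    lemma = solve-∀

  above-occurs : ∀ {a i} → d + a + i - 1ℤ ≤ R a i → ∃[ i′ ] (i < i′ × a < τ i′)
  above-occurs {a} {i} p = unflip′ (Counting.positive⇒occurs (above a) { - i}
    (linear (gap (subst (λ z → d + a + z - 1ℤ ≤ R a z) (sym (ℤ.neg-involutive i)) p)) (lemma (R a (- - i)) (d + a + - - i))))
    where
    lemma : ∀ r e → r - (e - + 2) - 1ℤ ≡ r - (e - 1ℤ)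
    lemma = solve-∀
    shift : ∀ i j → - j + 1ℤ - (i + 1ℤ) ≡ - i - j
    shift = solve-∀
    unflip′ : ∃[ j ] (j ≤ - i × a < τ (- j + 1ℤ)) → ∃[ i′ ] (i < i′ × a < τ i′)
    unflip′ (j , j≤-i , q) = - j + 1ℤ , 1+≤⇒< (linear (gap j≤-i) (shift i j)) , q

  above-unique : ∀ {a i j j′} → R a i ≤ d + a + i - 1ℤ → i < j → i < j′ → a < τ j → a < τ j′ → j ≡ j′
  above-unique {a} {i} {j} {j′} p i<j i<j′ q q′ = trans (lemma₁ j) (trans (cong (λ z → 1ℤ - z)
    (Counting.occurs-once (above a) { - i}
      (linear (gap (subst (λ z → R a z ≤ d + a + z - 1ℤ) (sym (ℤ.neg-involutive i)) p)) (lemma₂ (R a (- - i)) (d + a + - - i)))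
      (flip-≤ i<j) (flip-≤ i<j′) (flip-τ q) (flip-τ q′))) (sym (lemma₁ j′)))
    where
    lemma₁ : ∀ j → j ≡ 1ℤ - (1ℤ - j)
    lemma₁ = solve-∀
    lemma₂ : ∀ r e → 1ℤ - (r - (e - + 2)) ≡ e - 1ℤ - r
    lemma₂ = solve-∀

  -- Half-open, in agreement with the counts: weak inequalities at the lower point, strict ones at
  -- the upper point.
  record Box (i₂ i₁ a i : ℤ) : Set where
    constructor box
    field
      left   : i₂ ≤ i
      right  : i < i₁
      bottom : τ i₂ ≤ a
      top    : a < τ i₁

  Degree1 : ℤ → ℤ → Set
  Degree1 a i = d + a + i ≡ 1ℤ

  -- In degree 1 both counts equal `R a i + 1ℤ`, so one hypothesis supplies a point below and a
  -- point above.
  effective⇒box : ∀ {a i} → Degree1 a i → 0ℤ ≤ R a i → ∃[ i₂ ] ∃[ i₁ ] Box i₂ i₁ a i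
  effective⇒box {a} {i} deg p = pair (below-occurs p) (above-occurs (subst (_≤ R a i) (cong (_- 1ℤ) (sym deg)) p))
    where
    pair : ∃[ i₂ ] (i₂ ≤ i × τ i₂ ≤ a) → ∃[ i₁ ] (i < i₁ × a < τ i₁) → ∃[ i₂ ] ∃[ i₁ ] Box i₂ i₁ a i
    pair (i₂ , l , b) (i₁ , r , t) = i₂ , i₁ , box l r b t

  box⇒effective : ∀ {i₂ i₁ a i} → Box i₂ i₁ a i → 0ℤ ≤ R a i
  box⇒effective (box le _ q _) = below-positive le q

  -- In degree 1 the rank is at most 0, so each of the two counts is at most 1.
  box-determined : ∀ {i₂ i₁ j₂ j₁ a i} → Degree1 a i → Box i₂ i₁ a i → Box j₂ j₁ a i → i₂ ≡ j₂ × i₁ ≡ j₁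
  box-determined {a = a} {i} deg (box l r b t) (box l′ r′ b′ t′) =
    below-unique (R-deg1 a i deg) l l′ b b′ ,
    above-unique (subst (R a i ≤_) (cong (_- 1ℤ) (sym deg)) (R-deg1 a i deg)) r r′ t t′

  -- Two degree-1 positions in one box would have an effective corner of
  -- degree 0 and, opposite to it, a corner equivalent to u + v of rank 1.
  position-≮ : ∀ {i₂ i₁ a i a′ i′} → Degree1 a i → Degree1 a′ i′ →
               Box i₂ i₁ a i → Box i₂ i₁ a′ i′ → ¬ i < i′
  position-≮ {i₂} {i₁} {a} {i} {a′} {i′} deg deg′ (box l r b t) (box l′ r′ b′ t′) i<i′ =
    absurd-gap (gap (ℤ.≤-trans opposite (R-deg0 a′ i corner-deg corner))) refl
    where
    corner : 0ℤ ≤ R a′ i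
    corner = below-positive l b′
    0≤deg : 0ℤ ≤ d + a′ + i
    0≤deg with 0ℤ ℤ.≤? d + a′ + i
    ... | yes p = p
    ... | no ¬p = absurd-gap (subst (0ℤ ≤_) (negative a′ i (ℤ.≰⇒> ¬p)) corner) refl
    corner-deg : d + a′ + i ≡ 0ℤ
    corner-deg = ℤ.≤-antisym (linear (gap (<⇒1+≤ i<i′))
      (trans (lemma d a′ i i′) (trans (cong (λ z → 1ℤ - z + (i′ - (i + 1ℤ))) deg′) (ℤ.+-identityˡ _)))) 0≤deg
      where
      lemma : ∀ d a i i′ → 0ℤ - (d + a + i) ≡ 1ℤ - (d + a + i′) + (i′ - (i + 1ℤ))
      lemma = solve-∀
    -- Since `(a′, i)` has degree 0, the two positions are the remaining neighbours in a unit
    -- square, with `(a′ + 1ℤ, i + 1ℤ)` opposite to `(a′, i)`.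
    a≡ : a ≡ a′ + 1ℤ
    a≡ = trans (lemma₁ d a i) (trans (cong (λ y → y - (d + i)) deg)
           (trans (cong (λ z → z + 1ℤ - (d + i)) (sym corner-deg)) (lemma₂ d a′ i)))
      where
      lemma₁ : ∀ d a i → a ≡ d + a + i - (d + i)
      lemma₁ = solve-∀
      lemma₂ : ∀ d a′ i → d + a′ + i + 1ℤ - (d + i) ≡ a′ + 1ℤ
      lemma₂ = solve-∀
    i′≡ : i′ ≡ i + 1ℤ
    i′≡ = trans (lemma₁ d a′ i′) (trans (cong (λ y → y - (d + a′)) deg′)
           (trans (cong (λ z → z + 1ℤ - (d + a′)) (sym corner-deg)) (lemma₂ d a′ i)))
      where
      lemma₁ : ∀ d a i → i ≡ d + a + i - (d + a)
      lemma₁ = solve-∀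
      lemma₂ : ∀ d a′ i → d + a′ + i + 1ℤ - (d + a′) ≡ i + 1ℤ
      lemma₂ = solve-∀
    -- The upper point of the box lies above this corner, so its rank is at least deg - 1, and its
    -- degree is 2.
    opposite : 1ℤ ≤ R (a′ + 1ℤ) (i + 1ℤ)
    opposite = subst₂ (λ y z → 1ℤ ≤ R y z) a≡ i′≡
      (subst (_≤ R a i′) (trans (cong₂ (λ y z → d + y + z - 1ℤ) a≡ i′≡)
        (trans (lemma d a′ i) (cong (λ z → z + 1ℤ) corner-deg)))
        (above-positive r′ t))
      where
      lemma : ∀ d a i → d + (a + 1ℤ) + (i + 1ℤ) - 1ℤ ≡ d + a + i + 1ℤ
      lemma = solve-∀

  position-determined : ∀ {i₂ i₁ a i a′ i′} → Degree1 a i → Degree1 a′ i′ →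
                        Box i₂ i₁ a i → Box i₂ i₁ a′ i′ → i ≡ i′
  position-determined {i = i} {i′ = i′} deg deg′ B B′ with ℤ.<-cmp i i′
  ... | tri< lt _ _ = contradiction lt (position-≮ deg deg′ B B′)
  ... | tri≈ _ e _  = e
  ... | tri> _ _ gt = contradiction gt (position-≮ deg′ deg B′ B)

  module _ {i₂ i₁ : ℤ} (i₂<i₁ : i₂ < i₁) (τ<τ : τ i₂ < τ i₁) where
    private
      a₂ a₁ : ℤ
      a₂ = τ i₂
      a₁ = τ i₁

      corner : 0ℤ ≤ R a₂ i₂
      corner = below-positive ℤ.≤-refl ℤ.≤-refl

      corner-above : d + a₂ + i₂ - 1ℤ ≤ R a₂ i₂
      corner-above = above-positive i₂<i₁ τ<τ

    0≤corner-deg : 0ℤ ≤ d + a₂ + i₂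
    0≤corner-deg with 0ℤ ℤ.≤? d + a₂ + i₂
    ... | yes p = p
    ... | no ¬p = absurd-gap (subst (0ℤ ≤_) (negative a₂ i₂ (ℤ.≰⇒> ¬p)) corner) refl

    -- The diagonal neighbour of a rank-1 corner of degree 2 would be an
    -- effective divisor of degree 0, making the corner equivalent to u + v.
    corner-deg≢2 : d + a₂ + i₂ ≢ + 2
    corner-deg≢2 deg = absurd-gap (gap 1≤R ⊕ gap R≤0) (cancel (R a₂ i₂))
      where
      1≤R : 1ℤ ≤ R a₂ i₂
      1≤R = subst (_≤ R a₂ i₂) (cong (_- 1ℤ) deg) corner-above
      -- Row `i₂` jumps at `a₂`, not before: at `a₂ - 1ℤ` removing v does not lower the rank.
      flat : R (a₂ - 1ℤ) i₂ ≡ R (a₂ - 1ℤ) (i₂ - 1ℤ)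
      flat = ℤ.i-j≡0⇒i≡j _ _ (trans (jump (a₂ - 1ℤ) i₂)
        (δ-no (a₂ ℤ.≤? a₂ - 1ℤ) (λ p → absurd-gap (gap p) (lemma a₂))))
        where
        lemma : ∀ t → t - 1ℤ - t ≡ -1ℤ
        lemma = solve-∀
      R≤0 : R a₂ i₂ ≤ 0ℤ
      R≤0 = subst₂ (λ y z → R y z ≤ 0ℤ) (back a₂) (back i₂)
        (R-deg0 (a₂ - 1ℤ) (i₂ - 1ℤ) (trans (lemma d a₂ i₂) (cong (_- + 2) deg))
          (subst (0ℤ ≤_) flat (R-lower a₂ i₂ 1≤R)))
        where
        back : ∀ t → t - 1ℤ + 1ℤ ≡ t
        back = solve-∀
        lemma : ∀ d a i → d + (a - 1ℤ) + (i - 1ℤ) ≡ d + a + i - + 2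
        lemma = solve-∀
      cancel : ∀ r → r - 1ℤ + (0ℤ - r) ≡ -1ℤ
      cancel = solve-∀

    -- In degree at least 3 the rank deg - 2 would leave no point above the corner, but the upper
    -- point of the box is one.
    corner-deg≤1 : d + a₂ + i₂ ≤ 1ℤ
    corner-deg≤1 with d + a₂ + i₂ ℤ.≤? 1ℤ
    ... | yes p = p
    ... | no ¬p with ≤⇒<∨≡ (≰⇒1+≤ ¬p)
    ...   | inj₂ e  = contradiction (sym e) corner-deg≢2
    ...   | inj₁ 3≤ = absurd-gap (gap (subst (d + a₂ + i₂ - 1ℤ ≤_) (large a₂ i₂ 3≤) corner-above)) (lemma (d + a₂ + i₂))
      where
      lemma : ∀ e → e - + 2 - (e - 1ℤ) ≡ -1ℤ
      lemma = solve-∀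

    -- The upper point `(a₁, i₁)` has both points weakly below it, hence rank at least 1; with a
    -- lower corner of degree 0 it would be equivalent to u + v.
    unit-box-deg≢0 : a₁ ≡ a₂ + 1ℤ → i₁ ≡ i₂ + 1ℤ → d + a₂ + i₂ ≢ 0ℤ
    unit-box-deg≢0 a≡ i≡ deg = absurd-gap (gap twice ⊕ gap (R-deg0 a₂ i₂ deg corner)) (lemma (R (a₂ + 1ℤ) (i₂ + 1ℤ)))
      where
      twice : + 2 ≤ R (a₂ + 1ℤ) (i₂ + 1ℤ) + 1ℤ
      twice = subst₂ (λ y z → + 2 ≤ R y z + 1ℤ) a≡ i≡
        (Counting.occurs-twice (below a₁) ℤ.≤-refl i₂<i₁ (ℤ.<⇒≤ τ<τ) ℤ.≤-refl)
      lemma : ∀ r → r + 1ℤ - + 2 + (0ℤ - r) ≡ -1ℤ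
      lemma = solve-∀

    corner-deg0 : d + a₂ + i₂ + 1ℤ ≤ 1ℤ → d + a₂ + i₂ ≡ 0ℤ
    corner-deg0 p = ℤ.≤-antisym (linear (gap p) (shift (d + a₂ + i₂))) 0≤corner-deg
      where
      shift : ∀ e → 0ℤ - e ≡ 1ℤ - (e + 1ℤ)
      shift = solve-∀

    -- The lower corner has degree 0 or 1. In degree 1 it is the position; in degree 0 one step in
    -- the u or v direction reaches degree 1 and stays in the box unless the box is a unit square.
    box-position : ∃[ a ] ∃[ i ] (Degree1 a i × Box i₂ i₁ a i)
    box-position = cases (≤⇒<∨≡ corner-deg≤1) (≤⇒<∨≡ (<⇒1+≤ τ<τ)) (≤⇒<∨≡ (<⇒1+≤ i₂<i₁))
      where
      above-deg : ∀ d a i → d + (a + 1ℤ) + i ≡ d + a + i + 1ℤ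
      above-deg = solve-∀
      right-deg : ∀ d a i → d + a + (i + 1ℤ) ≡ d + a + i + 1ℤ
      right-deg = solve-∀
      i≤i+1 : ∀ i → i ≤ i + 1ℤ
      i≤i+1 i = linear (0≤+ 1) (lemma i)
        where
        lemma : ∀ i → i + 1ℤ - i ≡ 1ℤ
        lemma = solve-∀
      cases : d + a₂ + i₂ + 1ℤ ≤ 1ℤ ⊎ d + a₂ + i₂ ≡ 1ℤ →
              a₂ + 1ℤ + 1ℤ ≤ a₁ ⊎ a₂ + 1ℤ ≡ a₁ → i₂ + 1ℤ + 1ℤ ≤ i₁ ⊎ i₂ + 1ℤ ≡ i₁ →
              ∃[ a ] ∃[ i ] (Degree1 a i × Box i₂ i₁ a i)
      cases (inj₂ deg) _         _         = a₂ , i₂ , deg , box ℤ.≤-refl i₂<i₁ ℤ.≤-refl τ<τ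
      cases (inj₁ low) (inj₁ lt) _         = a₂ + 1ℤ , i₂ , trans (above-deg d a₂ i₂) (cong (_+ 1ℤ) (corner-deg0 low)) ,
                                             box ℤ.≤-refl i₂<i₁ (i≤i+1 a₂) (1+≤⇒< lt)
      cases (inj₁ low) (inj₂ _)  (inj₁ lt) = a₂ , i₂ + 1ℤ , trans (right-deg d a₂ i₂) (cong (_+ 1ℤ) (corner-deg0 low)) ,
                                             box (i≤i+1 i₂) (1+≤⇒< lt) ℤ.≤-refl τ<τ
      cases (inj₁ low) (inj₂ a≡) (inj₂ i≡) = contradiction (corner-deg0 low) (unit-box-deg≢0 (sym a≡) (sym i≡))

module _ {d R} (L : RankLattice d R) where

  -- `τ` comes from the rows and `σ` from the columns. Both locate the ones of the same 0-1 matrix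
  -- `mixedDifference R`, so they are mutually inverse.
  transmission-permutation : Σ (ℤ → ℤ) λ τ → Σ (ℤ → ℤ) λ σ →
    ((∀ a i → δ (τ i ℤ.≟ a) ≡ mixedDifference R a i) × (∀ a → τ (σ a) ≡ a) × (∀ i → σ (τ i) ≡ i))
  transmission-permutation = τ , σ , rows ,
    (λ a → δ≡1⇒ (τ (σ a) ℤ.≟ a) (trans (rows a (σ a)) (trans (sym (columns a (σ a))) (δ-yes (σ a ℤ.≟ σ a) refl)))) ,
    (λ i → δ≡1⇒ (σ (τ i) ℤ.≟ i) (trans (columns (τ i) i) (trans (sym (rows (τ i) i)) (δ-yes (τ i ℤ.≟ τ i) refl))))
    where
    τ σ : ℤ → ℤ
    τ i = proj₁ (row-step L i)
    σ a = proj₁ (row-step (transpose L) a)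
    rows : ∀ a i → δ (τ i ℤ.≟ a) ≡ mixedDifference R a i
    rows a i = mixedDifference-δ L (τ i) i (proj₂ (row-step L i)) a
    columns : ∀ a i → δ (σ a ℤ.≟ i) ≡ mixedDifference R a i
    columns a i = trans (mixedDifference-δ (transpose L) (σ a) a (proj₂ (row-step (transpose L) a)) i)
      (exchange (R a i) (R a (i - 1ℤ)) (R (a - 1ℤ) i) (R (a - 1ℤ) (i - 1ℤ)))
      where
      exchange : ∀ r s t w → r - s - t + w ≡ r - t - s + w
      exchange = solve-∀

-- Inversions modulo k

∣-difference⇒≡ : ∀ {k m n} → m ℕ.< k → n ℕ.< k → + k ∣ + m - + n → m ≡ n
∣-difference⇒≡ {k} {m} {n} m<k n<k k∣ = ℤ.+-injective (ℤ.i-j≡0⇒i≡j (+ m) (+ n) (ℤ.∣i∣≡0⇒i≡0 (zero-case _ refl k∣)))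
  where
  small : ∣ + m - + n ∣ ℕ.< k
  small = ℕ.≤-<-trans (subst (λ z → ∣ z ∣ ℕ.≤ m ℕ.⊔ n) (sym (ℤ.[+m]-[+n]≡m⊖n m n)) (ℤ.∣m⊝n∣≤m⊔n m n)) (ℕ.⊔-lub m<k n<k)
  zero-case : ∀ d → d ≡ ∣ + m - + n ∣ → + k ∣ + m - + n → d ≡ 0
  zero-case zero    _  _ = refl
  zero-case (suc d) eq p = contradiction (subst (k ℕ.∣_) (sym eq) p)
                             (ℕ.>⇒∤ (subst (ℕ._< k) (sym eq) small))

-- The list is kept increasing: this gives injectivity, and an ordered triple as soon as there are
-- three entries.
record Enumeration {n} (P : Fin n → Set) : Set where
  field
    size     : ℕ
    at       : Fin size → Fin n
    monotone : ∀ {i j} → i Fin.< j → at i Fin.< at j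
    sound    : ∀ i → P (at i)
    complete : ∀ c → P c → ∃[ i ] at i ≡ c

enumerate : ∀ {n} (P : Fin n → Set) → (∀ c → Dec (P c)) → Enumeration P
enumerate {zero}  P P? = record { size = 0 ; at = λ () ; monotone = λ { {()} } ; sound = λ () ; complete = λ () }
enumerate {suc n} P P? = extend (P? Fin.zero) (enumerate (P ∘ Fin.suc) (P? ∘ Fin.suc))
  where
  extend : Dec (P Fin.zero) → Enumeration (P ∘ Fin.suc) → Enumeration P
  extend (no ¬p) E = record
    { size     = size
    ; at       = λ i → Fin.suc (at i)
    ; monotone = λ i<j → s≤s (monotone i<j)
    ; sound    = sound
    ; complete = λ { Fin.zero p → contradiction p ¬p
                   ; (Fin.suc c) p → let i , eq = complete c p in i , cong Fin.suc eq }
    }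
    where open Enumeration E
  extend (yes p₀) E = record
    { size     = suc size
    ; at       = λ { Fin.zero → Fin.zero ; (Fin.suc i) → Fin.suc (at i) }
    ; monotone = λ { {Fin.zero}  {Fin.suc j} _         → s≤s z≤n
                   ; {Fin.suc i} {Fin.suc j} (s≤s i<j) → s≤s (monotone i<j) }
    ; sound    = λ { Fin.zero → p₀ ; (Fin.suc i) → sound i }
    ; complete = λ { Fin.zero _ → Fin.zero , refl
                   ; (Fin.suc c) p → let i , eq = complete c p in Fin.suc i , cong Fin.suc eq }
    }
    where open Enumeration E

three : ∀ {N} → 3 ℕ.≤ N → Σ (Fin N) λ i → Σ (Fin N) λ j → Σ (Fin N) λ l → i Fin.< j × j Fin.< l
three (s≤s (s≤s (s≤s _))) = Fin.zero , Fin.suc Fin.zero , Fin.suc (Fin.suc Fin.zero) , s≤s z≤n , s≤s (s≤s z≤n)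

-- Inversion classes against effective twists of degree 1

module Transmission {d R} (L : GenusTwoLattice d R) (k : ℕ)
    (periodic : ∀ c a i → R (a + c * + k) (i - c * + k) ≡ R a i)
    (τ : ℤ → ℤ) (transmits : ∀ a b → δ (τ b ℤ.≟ a) ≡ mixedDifference R a (- b)) where
  open GenusTwoLattice L

  -- The transmission permutation twists by - b v, the lattice by + i v. Under the negation an
  -- inversion `p` becomes the pair `- snd p < - fst p` on which `τ⁻` increases, that is, a lower
  -- and an upper point of a box.
  τ⁻ : ℤ → ℤ
  τ⁻ i = τ (- i)

  transmits⁻ : ∀ a i → δ (τ⁻ i ℤ.≟ a) ≡ mixedDifference R a i
  transmits⁻ a i = trans (transmits a (- i)) (cong (mixedDifference R a) (ℤ.neg-involutive i))

  open Boxes L τ⁻ (λ a i → permutation-jump lattice (τ⁻ i) i (λ a → transmits⁻ a i) a)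

  mixedDifference-periodic : ∀ c a i → mixedDifference R (a + c * + k) (i - c * + k) ≡ mixedDifference R a i
  mixedDifference-periodic c a i = cong₂ _+_
    (cong₂ _-_ (cong₂ _-_ (periodic c a i) (trans shift-a (periodic c (a - 1ℤ) i))) (trans shift-i (periodic c a (i - 1ℤ))))
    (trans (cong₂ R (pred-+ a t) (pred-+ i (- t))) (periodic c (a - 1ℤ) (i - 1ℤ)))
    where
    t : ℤ
    t = c * + k
    pred-+ : ∀ a t → a + t - 1ℤ ≡ a - 1ℤ + t
    pred-+ = solve-∀
    shift-a : R (a + t - 1ℤ) (i - t) ≡ R (a - 1ℤ + t) (i - t)
    shift-a = cong (λ z → R z (i - t)) (pred-+ a t)
    shift-i : R (a + t) (i - t - 1ℤ) ≡ R (a + t) (i - 1ℤ - t)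
    shift-i = cong (R (a + t)) (pred-+ i (- t))

  -- The matrix `mixedDifference R` is invariant under translation by multiples of (k, -k), and each
  -- row has a single one.
  τ⁻-periodic : ∀ c i → τ⁻ (i - c * + k) ≡ τ⁻ i + c * + k
  τ⁻-periodic c i = δ≡1⇒ (τ⁻ (i - c * + k) ℤ.≟ τ⁻ i + c * + k)
    (trans (transmits⁻ (τ⁻ i + c * + k) (i - c * + k)) (trans (mixedDifference-periodic c (τ⁻ i) i)
      (trans (sym (transmits⁻ (τ⁻ i) i)) (δ-yes (τ⁻ i ℤ.≟ τ⁻ i) refl))))

  box-translate : ∀ {i₂ i₁ a i} c → Box i₂ i₁ a i → Box (i₂ - c * + k) (i₁ - c * + k) (a + c * + k) (i - c * + k)
  box-translate {i₂} {i₁} {a} c (box l r b t) = box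
    (ℤ.+-monoˡ-≤ _ l) (ℤ.+-monoˡ-< _ r)
    (subst (_≤ a + c * + k) (sym (τ⁻-periodic c i₂)) (ℤ.+-monoˡ-≤ (c * + k) b))
    (subst (a + c * + k <_) (sym (τ⁻-periodic c i₁)) (ℤ.+-monoˡ-< (c * + k) t))

  -- The degree-1 twists of D, indexed so that adding 1 to c adds [u - v].
  RankAt : ℤ → ℤ
  RankAt c = R (1ℤ - d + c) (- c)

  rankAt-degree1 : ∀ c → Degree1 (1ℤ - d + c) (- c)
  rankAt-degree1 c = lemma d c
    where
    lemma : ∀ d c → d + (1ℤ - d + c) + - c ≡ 1ℤ
    lemma = solve-∀

  Contains : Inversion τ → ℤ → Set
  Contains p c = Box (- snd p) (- fst p) (1ℤ - d + c) (- c)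

  effective⇒inversion : ∀ c → 0ℤ ≤ RankAt c → ∃[ p ] Contains p c
  effective⇒inversion c p = make (effective⇒box (rankAt-degree1 c) p)
    where
    make : ∃[ i₂ ] ∃[ i₁ ] Box i₂ i₁ (1ℤ - d + c) (- c) → ∃[ p ] Contains p c
    make (i₂ , i₁ , B@(box l r b t)) =
      record { fst = - i₁ ; snd = - i₂ ; fst<snd = ℤ.neg-mono-< (ℤ.≤-<-trans l r) ; inverted = ℤ.≤-<-trans b t } ,
      subst₂ (λ y z → Box y z (1ℤ - d + c) (- c)) (sym (ℤ.neg-involutive i₂)) (sym (ℤ.neg-involutive i₁)) B

  inversion⇒contains : ∀ p → ∃[ c ] Contains p c
  inversion⇒contains p = make (box-position (ℤ.neg-mono-< (fst<snd p))
      (subst₂ (λ y z → τ y < τ z) (sym (ℤ.neg-involutive (snd p))) (sym (ℤ.neg-involutive (fst p))) (inverted p)))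
    where
    make : ∃[ a ] ∃[ i ] (Degree1 a i × Box (- snd p) (- fst p) a i) → ∃[ c ] Contains p c
    make (a , i , deg , B) = - i , subst₂ (Box (- snd p) (- fst p)) a≡ (sym (ℤ.neg-involutive i)) B
      where
      a≡ : a ≡ 1ℤ - d + - i
      a≡ = trans (lemma d a i) (cong (λ z → z - d + - i) deg)
        where
        lemma : ∀ d a i → a ≡ d + a + i - d + - i
        lemma = solve-∀

  contains-translate : ∀ {p t} c → Contains p t →
    Box (- snd p - c * + k) (- fst p - c * + k) (1ℤ - d + (t + c * + k)) (- (t + c * + k))
  contains-translate {p} {t} c B = subst₂ (Box (- snd p - c * + k) (- fst p - c * + k))
    (ℤ.+-assoc (1ℤ - d) t (c * + k)) (sym (ℤ.neg-distrib-+ t (c * + k))) (box-translate c B)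

  contains-unique : ∀ {p t t′} → Contains p t → Contains p t′ → t ≡ t′
  contains-unique {t = t} {t′} B B′ = ℤ.neg-injective (position-determined (rankAt-degree1 t) (rankAt-degree1 t′) B B′)

  contains-equivalent : ∀ {p q t} → p ≈[ k ] q → Contains p t → ∃[ c ] Contains q (t + c * + k)
  contains-equivalent {p} {q} {t} (fst≡snd , k∣) B = c ,
      subst₂ (λ y z → Box y z (1ℤ - d + (t + c * + k)) (- (t + c * + k)))
        (trans (cong (λ z → - snd p - z) (trans c*k≡ (cong -_ fst≡snd))) (lemma₁ (snd p) (snd q)))
        (trans (cong (λ z → - fst p - z) c*k≡) (lemma₁ (fst p) (fst q)))
        (contains-translate {p} c B)
    where
    open Signed._∣_ (∣ᵤ⇒∣ {+ k} {fst p - fst q} k∣)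
    c : ℤ
    c = - quotient
    c*k≡ : c * + k ≡ - (fst p - fst q)
    c*k≡ = trans (sym (ℤ.neg-distribˡ-* quotient (+ k))) (cong -_ (sym equality))
    lemma₁ : ∀ y z → - y - - (y - z) ≡ - z
    lemma₁ = solve-∀

  -- Both positions can be translated by multiples of `k` into the box of `r`, where the position of
  -- degree 1 is unique.
  contains-congruent : ∀ {p q r t t′} → p ≈[ k ] r → q ≈[ k ] r → Contains p t → Contains q t′ → + k ∣ t - t′
  contains-congruent {p} {q} {r} {t} {t′} p≈r q≈r B B′ =
      ∣⇒∣ᵤ (divides (c′ - c) (trans (lemma₁ t t′ (c * + k)) (trans (cong (λ z → z - c * + k - t′) same) (lemma₂ t′ c c′ (+ k)))))
    where
    c c′ : ℤ
    c  = proj₁ (contains-equivalent {p} {r} p≈r B)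
    c′ = proj₁ (contains-equivalent {q} {r} q≈r B′)
    same : t + c * + k ≡ t′ + c′ * + k
    same = contains-unique {r} (proj₂ (contains-equivalent {p} {r} p≈r B)) (proj₂ (contains-equivalent {q} {r} q≈r B′))
    lemma₁ : ∀ t t′ z → t - t′ ≡ t + z - z - t′
    lemma₁ = solve-∀
    lemma₂ : ∀ t′ c c′ k → t′ + c′ * k - c * k - t′ ≡ (c′ - c) * k
    lemma₂ = solve-∀

  ≈-refl : ∀ (p : Inversion τ) → p ≈[ k ] p
  ≈-refl p = trans (ℤ.+-inverseʳ (fst p)) (sym (ℤ.+-inverseʳ (snd p))) ,
             ∣⇒∣ᵤ {+ k} (divides 0ℤ (trans (ℤ.+-inverseʳ (fst p)) (sym (ℤ.*-zeroˡ (+ k)))))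

  -- A position of degree 1 determines its box, so the box of `q` is the translate of the box of
  -- `p`.
  contains⇒equivalent : ∀ {p q t} c → Contains p t → Contains q (t + c * + k) → p ≈[ k ] q
  contains⇒equivalent {p} {q} {t} c B B′ = trans fst≡ (sym snd≡) , ∣⇒∣ᵤ (divides (- c) (trans fst≡ (ℤ.neg-distribˡ-* c (+ k))))
    where
    determined : - snd p - c * + k ≡ - snd q × - fst p - c * + k ≡ - fst q
    determined = box-determined (rankAt-degree1 (t + c * + k)) (contains-translate {p} c B) B′
    solve-for : ∀ y z t → - y - t ≡ - z → y - z ≡ - t
    solve-for y z t eq = trans (cong (λ w → y + w) (sym eq)) (lemma y t)
      where
      lemma : ∀ y t → y + (- y - t) ≡ - t
      lemma = solve-∀
    fst≡ : fst p - fst q ≡ - (c * + k)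
    fst≡ = solve-for (fst p) (fst q) (c * + k) (proj₂ determined)
    snd≡ : snd p - snd q ≡ - (c * + k)
    snd≡ = solve-for (snd p) (snd q) (c * + k) (proj₁ determined)

  -- Three inversions in at most two classes: two share a representative, so their positions agree
  -- modulo `k`. The conclusion is left as a collision, because the caller refutes only those with
  -- index 0.
  effective-collide : ∀ {N} → IsInv k τ N → N ℕ.≤ 2 → (c : Fin 3 → ℕ) → (∀ i → c i ℕ.< k) →
                      (∀ i → 0ℤ ≤ RankAt (+ c i)) → ∃[ i ] ∃[ j ] (i Fin.< j × c i ≡ c j)
  effective-collide (rep , _ , cover) N≤2 c c<k eff = collide (pigeonhole (s≤s N≤2) class)
    where
    inv : Fin 3 → Inversion τ
    inv i = proj₁ (effective⇒inversion (+ c i) (eff i))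
    class : Fin 3 → Fin _
    class i = proj₁ (cover (inv i))
    collide : ∃[ i ] ∃[ j ] (i Fin.< j × class i ≡ class j) → ∃[ i ] ∃[ j ] (i Fin.< j × c i ≡ c j)
    collide (i , j , i<j , same) = i , j , i<j , ∣-difference⇒≡ (c<k i) (c<k j)
      (contains-congruent {inv i} {inv j} {rep (class j)}
        (subst (λ z → inv i ≈[ k ] rep z) same (proj₂ (cover (inv i)))) (proj₂ (cover (inv j)))
        (proj₂ (effective⇒inversion (+ c i) (eff i))) (proj₂ (effective⇒inversion (+ c j) (eff j))))

  module _ .{{_ : NonZero k}} where
    private
      E : Enumeration {k} (λ c → 0ℤ ≤ RankAt (+ toℕ c))
      E = enumerate _ (λ c → 0ℤ ℤ.≤? RankAt (+ toℕ c))
      open Enumeration E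

    -- One representative for each effective residue below `k`; the position of an arbitrary
    -- inversion is reduced modulo `k` to find its representative.
    inversions : ∃[ N ] IsInv k τ N
    inversions = size , rep , separate , cover
      where
      rep : Fin size → Inversion τ
      rep i = proj₁ (effective⇒inversion (+ toℕ (at i)) (sound i))
      rep-contains : ∀ i → Contains (rep i) (+ toℕ (at i))
      rep-contains i = proj₂ (effective⇒inversion (+ toℕ (at i)) (sound i))
      at-injective : ∀ {i j} → toℕ (at i) ≡ toℕ (at j) → i ≡ j
      at-injective {i} {j} eq with Fin.<-cmp i j
      ... | tri< i<j _ _ = contradiction eq (ℕ.<⇒≢ (monotone i<j))
      ... | tri≈ _ i≡j _ = i≡j
      ... | tri> _ _ i>j = contradiction (sym eq) (ℕ.<⇒≢ (monotone i>j))
      separate : ∀ i j → rep i ≈[ k ] rep j → i ≡ j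
      separate i j p = at-injective (∣-difference⇒≡ (toℕ<n (at i)) (toℕ<n (at j))
        (contains-congruent {rep i} {rep j} {rep j} p (≈-refl (rep j)) (rep-contains i) (rep-contains j)))
      cover : ∀ p → ∃[ i ] p ≈[ k ] rep i
      cover p = proj₁ found , contains⇒equivalent {p} {rep (proj₁ found)} c (proj₂ (inversion⇒contains p))
                  (subst (Contains (rep (proj₁ found))) same (rep-contains (proj₁ found)))
        where
        t c : ℤ
        t = proj₁ (inversion⇒contains p)
        -- The translation that takes `t` to its remainder.
        c = - (t /ℕ k)
        r : Fin k
        r = fromℕ< (n%ℕd<d t k)
        r≡ : + toℕ r ≡ t + c * + k
        r≡ = trans (cong +_ (toℕ-fromℕ< (n%ℕd<d t k))) (trans (lemma (+ (t %ℕ k)) (t /ℕ k) (+ k))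
               (cong (λ z → z + c * + k) (sym (a≡a%ℕn+[a/ℕn]*n t k))))
          where
          lemma : ∀ r q k → r ≡ r + q * k + (- q) * k
          lemma = solve-∀
        effective : 0ℤ ≤ RankAt (+ toℕ r)
        effective = subst (λ z → 0ℤ ≤ RankAt z) (sym r≡) (box⇒effective (contains-translate {p} c (proj₂ (inversion⇒contains p))))
        found : ∃[ i ] at i ≡ r
        found = complete r effective
        same : + toℕ (at (proj₁ found)) ≡ t + c * + k
        same = trans (cong (λ z → + toℕ z) (proj₂ found)) r≡

    inversions≤2 : (∀ {c₀ c₁ c₂} → c₀ ℕ.< c₁ → c₁ ℕ.< c₂ → c₂ ℕ.< k →
                      0ℤ ≤ RankAt (+ c₀) → 0ℤ ≤ RankAt (+ c₁) → 0ℤ ≤ RankAt (+ c₂) → ⊥) →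
                   proj₁ inversions ℕ.≤ 2
    inversions≤2 no-three with proj₁ inversions ℕ.≤? 2
    ... | yes p = p
    ... | no ¬p with three (ℕ.≰⇒> ¬p)
    ...   | i , j , l , i<j , j<l = contradiction
            (no-three (monotone i<j) (monotone j<l) (toℕ<n (at l)) (sound i) (sound j) (sound l)) λ ()

-- Twice-marked graphs

module _ (M : TwiceMarkedGraph) where
  open TwiceMarkedGraph M
  open ChipFiring graph

  twist : Divisor → ℤ → ℤ → Divisor
  twist D a i = D +ᵈ a ·ᵈ ⟨ u ⟩ +ᵈ i ·ᵈ ⟨ v ⟩

  deg-twist : ∀ D a i → deg (twist D a i) ≡ deg D + a + i
  deg-twist D a i = trans (deg-+ (D +ᵈ a ·ᵈ ⟨ u ⟩) (i ·ᵈ ⟨ v ⟩))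
    (cong₂ _+_ (trans (deg-+ D (a ·ᵈ ⟨ u ⟩)) (cong (λ z → deg D + z) (deg-multiple′ a u))) (deg-multiple′ i v))
    where
    deg-multiple′ : ∀ a w → deg (a ·ᵈ ⟨ w ⟩) ≡ a
    deg-multiple′ a w = trans (deg-· a ⟨ w ⟩) (trans (cong (a *_) (deg-⟨⟩ w)) (ℤ.*-identityʳ a))

  twistRank : Divisor → ℤ → ℤ → ℤ
  twistRank D a i = rank (twist D a i)

  Δ-twist : ∀ {E} D a i → E ≗ twist D a i → Δ M E ≡ mixedDifference (twistRank D) a i
  Δ-twist {E} D a i p = cong₂ _+_ (cong₂ _-_ (cong₂ _-_
      (rank-cong-≗ graph p)
      (rank-cong-≗ graph (λ x → trans (cong (_- ⟨ u ⟩ x) (p x)) (down-u (D x) a (⟨ u ⟩ x) i (⟨ v ⟩ x)))))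
      (rank-cong-≗ graph (λ x → trans (cong (_- ⟨ v ⟩ x) (p x)) (down-v (D x) a (⟨ u ⟩ x) i (⟨ v ⟩ x)))))
      (rank-cong-≗ graph (λ x → trans (cong (λ z → z - ⟨ u ⟩ x - ⟨ v ⟩ x) (p x)) (down-uv (D x) a (⟨ u ⟩ x) i (⟨ v ⟩ x))))
    where
    down-u : ∀ d a u i v → d + a * u + i * v - u ≡ d + (a - 1ℤ) * u + i * v
    down-u = solve-∀
    down-v : ∀ d a u i v → d + a * u + i * v - v ≡ d + a * u + (i - 1ℤ) * v
    down-v = solve-∀
    down-uv : ∀ d a u i v → d + a * u + i * v - u - v ≡ d + (a - 1ℤ) * u + (i - 1ℤ) * v
    down-uv = solve-∀

  Δ-twist⁻ : ∀ D a b → Δ M (D +ᵈ a ·ᵈ ⟨ u ⟩ -ᵈ b ·ᵈ ⟨ v ⟩) ≡ mixedDifference (twistRank D) a (- b)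
  Δ-twist⁻ D a b = Δ-twist D a (- b) (λ x → cong (λ z → D x + a * ⟨ u ⟩ x + z) (ℤ.neg-distribˡ-* b (⟨ v ⟩ x)))

  ∼⇒difference∼0 : ∀ {D E} → D ∼ E → D -ᵈ E ∼ 0ᵈ
  ∼⇒difference∼0 {D} {E} D∼E = +ᵈ-cong-∼ graph (λ x → - E x) D∼E ◅◅ ≗⇒∼ (λ x → ℤ.+-inverseʳ (E x))

  difference∼0⇒∼ : ∀ {D E} → D -ᵈ E ∼ 0ᵈ → D ∼ E
  difference∼0⇒∼ {D} {E} p = ≗⇒∼ (λ x → lemma (D x) (E x)) ◅◅ +ᵈ-cong-∼ graph E p ◅◅ ≗⇒∼ (λ x → ℤ.+-identityˡ (E x))
    where
    lemma : ∀ d e → d ≡ d - e + e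
    lemma = solve-∀

  torsion⇒order : ∀ {k} → HasTorsionOrder M k → HasOrder ([u-v] M) k
  torsion⇒order {k} (1≤k , k∼ , least) = 1≤k ,
    ≗⇒∼ (λ x → distrib (+ k) (⟨ u ⟩ x) (⟨ v ⟩ x)) ◅◅ ∼⇒difference∼0 k∼ ,
    λ j 1≤j p → least j 1≤j (difference∼0⇒∼ (≗⇒∼ (λ x → sym (distrib (+ j) (⟨ u ⟩ x) (⟨ v ⟩ x))) ◅◅ p))
    where
    distrib : ∀ c a b → c * (a - b) ≡ c * a - c * b
    distrib = solve-∀

  leastPositive-unique : ∀ {P j k} → IsLeastPositive P j → IsLeastPositive P k → j ≡ k
  leastPositive-unique (1≤j , pj , minj) (1≤k , pk , mink) = ℕ.≤-antisym (minj _ 1≤k pk) (mink _ 1≤j pj)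

  twistRank-periodic : ∀ {k} → + k ·ᵈ ⟨ u ⟩ ∼ + k ·ᵈ ⟨ v ⟩ →
    ∀ D c a i → twistRank D (a + c * + k) (i - c * + k) ≡ twistRank D a i
  twistRank-periodic {k} k∼ D c a i = rank-cong graph
    (≗⇒∼ (λ x → before (D x) a (⟨ u ⟩ x) i (⟨ v ⟩ x) c (+ k))
      ◅◅ +ᵈ-cong-∼ graph (twist D a (i - c * + k)) (·ᵈ-cong-∼ graph c k∼)
      ◅◅ ≗⇒∼ (λ x → after (D x) a (⟨ u ⟩ x) i (⟨ v ⟩ x) c (+ k)))
    where
    before : ∀ d a u i v c k → d + (a + c * k) * u + (i - c * k) * v ≡ c * (k * u) + (d + a * u + (i - c * k) * v)
    before = solve-∀
    after : ∀ d a u i v c k → c * (k * v) + (d + a * u + (i - c * k) * v) ≡ d + a * u + i * v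
    after = solve-∀

  -- Rigidly marked graphs of genus 2: their lattices and the two implications

  module _ (g≡2 : genus ≡ + 2) (rigid : RigidlyMarked M) where
    private
      A : Divisor
      A = ⟨ u ⟩ +ᵈ ⟨ v ⟩

      degA : deg A ≡ + 2
      degA = trans (deg-+ ⟨ u ⟩ ⟨ v ⟩) (cong₂ _+_ (deg-⟨⟩ u) (deg-⟨⟩ v))

      A≱1 : ¬ RankAtLeast A 1
      A≱1 p = absurd-gap (gap (subst (1ℤ ≤_) (proj₂ rigid) (rankAtLeast⇒≤rank graph {A} {1} p))) refl

    -- Otherwise Δ(u) ≥ 0 would force r(u) ≥ 1, hence r(u + v) ≥ 1.
    u≁v : ¬ ⟨ u ⟩ ∼ ⟨ v ⟩
    u≁v u∼v = A≱1 λ F effF degF → nonEmpty-resp-≗ (λ x → add-v (⟨ u ⟩ x) (⟨ v ⟩ x) (F x))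
      (nonEmpty-+ graph (≤rank⇒rankAtLeast graph {U} {1} 1≤rank F effF degF) (effective-⟨⟩ graph v))
      where
      -- The divisor u as a zero twist of itself, the shape in which `Submodular` speaks of it.
      U : Divisor
      U = ⟨ u ⟩ +ᵈ 0ℤ ·ᵈ ⟨ u ⟩ +ᵈ 0ℤ ·ᵈ ⟨ v ⟩
      add-v : ∀ u v f → u + 0ℤ * u + 0ℤ * v - f + v ≡ u + v - f
      add-v = solve-∀
      drop-u : ∀ u v → u + 0ℤ * u + 0ℤ * v - u ≡ 0ℤ
      drop-u = solve-∀
      drop-v : ∀ u v → u + 0ℤ * u + 0ℤ * v - v ≡ u - v
      drop-v = solve-∀
      drop-uv : ∀ u v → u + 0ℤ * u + 0ℤ * v - u - v ≡ 0ℤ - v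
      drop-uv = solve-∀
      trivial : ∀ {D} → D ∼ 0ᵈ → 0ℤ ≤ rank D
      trivial D∼0 = nonEmpty⇒0≤rank graph (0ᵈ , (λ _ → ℤ.≤-refl) , D∼0)
      0≤rank-u : 0ℤ ≤ rank (U -ᵈ ⟨ u ⟩)
      0≤rank-u = trivial (≗⇒∼ (λ x → drop-u (⟨ u ⟩ x) (⟨ v ⟩ x)))
      0≤rank-v : 0ℤ ≤ rank (U -ᵈ ⟨ v ⟩)
      0≤rank-v = trivial (≗⇒∼ (λ x → drop-v (⟨ u ⟩ x) (⟨ v ⟩ x)) ◅◅ ∼⇒difference∼0 u∼v)
      rank-uv : rank (U -ᵈ ⟨ u ⟩ -ᵈ ⟨ v ⟩) ≡ -1ℤ
      rank-uv = rank-negative graph (subst (_< 0ℤ) (sym (trans (deg-∼ (≗⇒∼ (λ x → drop-uv (⟨ u ⟩ x) (⟨ v ⟩ x))))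
        (trans (deg-- 0ᵈ ⟨ v ⟩) (cong₂ _-_ (sum-replicate-zero (Graph.#V graph)) (deg-⟨⟩ v))))) -<+)
      1≤rank : 1ℤ ≤ rank U
      1≤rank = linear (proj₁ rigid ⟨ u ⟩ 0ℤ 0ℤ ⊕ 0≤rank-u ⊕ 0≤rank-v)
        (trans (lemma (rank U) (rank (U -ᵈ ⟨ u ⟩)) (rank (U -ᵈ ⟨ v ⟩)))
          (cong (λ z → rank U - rank (U -ᵈ ⟨ u ⟩) - rank (U -ᵈ ⟨ v ⟩) + z + rank (U -ᵈ ⟨ u ⟩) + rank (U -ᵈ ⟨ v ⟩)) (sym rank-uv)))
        where
        lemma : ∀ a b c → a - 1ℤ ≡ a - b - c + -1ℤ + b + c
        lemma = solve-∀

    twist-lattice : ∀ D → GenusTwoLattice (deg D) (twistRank D)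
    twist-lattice D = record
      { lattice = record
        { negative   = λ a i p → rank-negative graph (subst (_< 0ℤ) (sym (deg-twist D a i)) p)
        ; large      = λ a i p → ℤ.≤-antisym
            (subst (λ e → twistRank D a i ≤ e - + 2) (deg-twist D a i)
              (rank≤deg-2 graph g≡2 degA (proj₂ rigid) (twist D a i) (subst (+ 3 ≤_) (sym (deg-twist D a i)) p)))
            (lower a i)
        ; submodular = λ a i → subst (0ℤ ≤_) (Δ-twist D a i (λ _ → refl)) (proj₁ rigid D a i)
        }
      ; -1≤R    = λ a i → -1≤rank graph (twist D a i)
      ; deg-2≤R = lower
      ; R-deg0  = λ a i deg0 0≤r → ℤ.≤-reflexive (trans (rank-cong graph (shift-by-A a i deg0 0≤r)) (proj₂ rigid))
      ; R-deg1  = degree1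
      ; R-lower = λ a i 1≤r → nonEmpty⇒0≤rank graph (nonEmpty-resp-≗ (λ x → down-u (D x) a (⟨ u ⟩ x) i (⟨ v ⟩ x))
          (≤rank⇒rankAtLeast graph {twist D a i} {1} 1≤r ⟨ u ⟩ (effective-⟨⟩ graph u) (deg-⟨⟩ u)))
      }
      where
      lower : ∀ a i → deg D + a + i - + 2 ≤ twistRank D a i
      lower a i = subst₂ (λ e g → e - g ≤ twistRank D a i) (deg-twist D a i) g≡2 (deg-genus≤rank graph (twist D a i))
      down-u : ∀ d a u i v → d + a * u + i * v - u ≡ d + (a - 1ℤ) * u + i * v
      down-u = solve-∀
      up-uv : ∀ d a u i v → d + (a + 1ℤ) * u + (i + 1ℤ) * v ≡ d + a * u + i * v + (u + v)
      up-uv = solve-∀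
      shift-by-A : ∀ a i → deg D + a + i ≡ 0ℤ → 0ℤ ≤ twistRank D a i → twist D (a + 1ℤ) (i + 1ℤ) ∼ A
      shift-by-A a i deg0 0≤r = ≗⇒∼ (λ x → up-uv (D x) a (⟨ u ⟩ x) i (⟨ v ⟩ x))
        ◅◅ +ᵈ-cong-∼ graph A (nonEmpty-deg0 graph (0≤rank⇒nonEmpty graph 0≤r) (trans (deg-twist D a i) deg0))
        ◅◅ ≗⇒∼ (λ x → ℤ.+-identityˡ (A x))
      degree1 : ∀ a i → deg D + a + i ≡ 1ℤ → twistRank D a i ≤ 0ℤ
      degree1 a i deg1 with twistRank D a i ℤ.≤? 0ℤ
      ... | yes p = p
      ... | no ¬p = contradiction (∼-sym (vertex u) ◅◅ vertex v) u≁v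
        where
        vertex : ∀ w → twist D a i ∼ ⟨ w ⟩
        vertex w = difference∼0⇒∼ (nonEmpty-deg0 graph
          (≤rank⇒rankAtLeast graph {twist D a i} {1} (≰⇒1+≤ ¬p) ⟨ w ⟩ (effective-⟨⟩ graph w) (deg-⟨⟩ w))
          (trans (deg-- (twist D a i) ⟨ w ⟩) (cong₂ _-_ (trans (deg-twist D a i) deg1) (deg-⟨⟩ w))))

    -- In the orbit of `⟨ w ⟩` the positions 0, `m` and `n` are effective, the first because `⟨ w ⟩`
    -- is. With at most two inversion classes two of them coincide, and neither `m` nor `n` is 0.
    transmission⇒nonRecurrent : ∀ {k} → HasTorsionOrder M k → HasGeneralTransmission M k → NonRecurrent ([u-v] M)
    transmission⇒nonRecurrent {k} torsion (_ , _ , general) = k , torsion⇒order torsion , at-most-one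
      where
      at-most-one : ∀ w m n → 1 ℕ.≤ m → m ℕ.< k → 1 ℕ.≤ n → n ℕ.< k →
        NonEmpty∣ + m ·ᵈ (⟨ u ⟩ -ᵈ ⟨ v ⟩) +ᵈ ⟨ w ⟩ ∣ → NonEmpty∣ + n ·ᵈ (⟨ u ⟩ -ᵈ ⟨ v ⟩) +ᵈ ⟨ w ⟩ ∣ → m ≡ n
      at-most-one w m n 1≤m m<k 1≤n n<k m-eff n-eff = compare (general ⟨ w ⟩)
        where
        position : Fin 3 → ℕ
        position 0F = 0
        position 1F = m
        position 2F = n
        position<k : ∀ j → position j ℕ.< k
        position<k 0F = proj₁ torsion
        position<k 1F = m<k
        position<k 2F = n<k
        effective : ∀ j → NonEmpty∣ + position j ·ᵈ (⟨ u ⟩ -ᵈ ⟨ v ⟩) +ᵈ ⟨ w ⟩ ∣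
        effective 0F = ⟨ w ⟩ , effective-⟨⟩ graph w , ≗⇒∼ (λ x → ℤ.+-identityˡ (⟨ w ⟩ x))
        effective 1F = m-eff
        effective 2F = n-eff
        -- `1ℤ - 1ℤ` stands for `1ℤ - deg ⟨ w ⟩`, the offset in `RankAt`.
        recentre : ∀ c u v w → c * (u - v) + w ≡ w + (1ℤ - 1ℤ + c) * u + - c * v
        recentre = solve-∀
        ranked : ∀ j → 0ℤ ≤ twistRank ⟨ w ⟩ (1ℤ - deg ⟨ w ⟩ + + position j) (- + position j)
        ranked j = nonEmpty⇒0≤rank graph (nonEmpty-resp-≗
          (λ x → trans (recentre (+ position j) (⟨ u ⟩ x) (⟨ v ⟩ x) (⟨ w ⟩ x))
            (cong (λ e → ⟨ w ⟩ x + (1ℤ - e + + position j) * ⟨ u ⟩ x + - + position j * ⟨ v ⟩ x) (sym (deg-⟨⟩ w))))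
          (effective j))
        distinct : ∃[ i ] ∃[ j ] (i Fin.< j × position i ≡ position j) → m ≡ n
        distinct (0F , 1F , _ , eq) = contradiction eq (ℕ.<⇒≢ 1≤m)
        distinct (0F , 2F , _ , eq) = contradiction eq (ℕ.<⇒≢ 1≤n)
        distinct (1F , 2F , _ , eq) = eq
        distinct (1F , 1F , s≤s () , _)
        distinct (2F , 1F , s≤s () , _)
        distinct (2F , 2F , s≤s (s≤s ()) , _)
        compare : ∃[ τ ] (IsTransmissionPermutation M ⟨ w ⟩ τ × ∃[ N ] (IsInv k τ N × + N ≤ genus)) → m ≡ n
        compare (τ , (_ , transmits) , N , isInv , N≤g) = distinct
          (Transmission.effective-collide (twist-lattice ⟨ w ⟩) k (twistRank-periodic (proj₁ (proj₂ torsion)) ⟨ w ⟩)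
            τ (λ a b → trans (transmits a b) (Δ-twist⁻ ⟨ w ⟩ a b))
            isInv (ℤ.drop‿+≤+ (subst (+ N ≤_) g≡2 N≤g)) position position<k ranked)

    -- Suppose that three positions `c₀`, `c₁`, `c₂` within a period are effective. The first is
    -- equivalent to a vertex `w`; counted from there, `c₁ ∸ c₀` and `c₂ ∸ c₀` are two distinct
    -- multiples that violate non-recurrence at `w`.
    nonRecurrent⇒transmission : ∀ {k} → HasTorsionOrder M k → NonRecurrent ([u-v] M) → HasGeneralTransmission M k
    nonRecurrent⇒transmission {k} torsion (k′ , order , at-most-one) =
      proj₁ (proj₂ torsion) , proj₁ rigid , λ D → general D (transmission-permutation (GenusTwoLattice.lattice (twist-lattice D)))
      where
      k′≡k : k′ ≡ k
      k′≡k = leastPositive-unique order (torsion⇒order torsion)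
      module _ (D : Divisor) where
        L : GenusTwoLattice (deg D) (twistRank D)
        L = twist-lattice D
        position : ℕ → Divisor
        position c = twist D (1ℤ - deg D + + c) (- + c)
        no-three : ∀ {c₀ c₁ c₂} → c₀ ℕ.< c₁ → c₁ ℕ.< c₂ → c₂ ℕ.< k →
          0ℤ ≤ rank (position c₀) → 0ℤ ≤ rank (position c₁) → 0ℤ ≤ rank (position c₂) → ⊥
        no-three {c₀} {c₁} {c₂} c₀<c₁ c₁<c₂ c₂<k p₀ p₁ p₂ = contradiction
          (ℕ.∸-cancelʳ-≡ (ℕ.<⇒≤ c₀<c₁) (ℕ.<⇒≤ c₀<c₂)
            (at-most-one w (c₁ ℕ.∸ c₀) (c₂ ℕ.∸ c₀)
              (ℕ.m<n⇒0<n∸m c₀<c₁) (small (ℕ.<-trans c₁<c₂ c₂<k)) (ℕ.m<n⇒0<n∸m c₀<c₂) (small c₂<k)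
              (effective c₀<c₁ p₁) (effective c₀<c₂ p₂)))
          (ℕ.<⇒≢ c₁<c₂)
          where
          c₀<c₂ : c₀ ℕ.< c₂
          c₀<c₂ = ℕ.<-trans c₀<c₁ c₁<c₂
          degree : ∀ d c → d + (1ℤ - d + c) + - c ≡ 1ℤ
          degree = solve-∀
          point : ∃[ w ] position c₀ ∼ ⟨ w ⟩
          point = nonEmpty-deg1 graph (0≤rank⇒nonEmpty graph p₀)
            (trans (deg-twist D (1ℤ - deg D + + c₀) (- + c₀)) (degree (deg D) (+ c₀)))
          w : Vertex
          w = proj₁ point
          small : ∀ {c} → c ℕ.< k → c ℕ.∸ c₀ ℕ.< k′
          small {c} c<k = subst (c ℕ.∸ c₀ ℕ.<_) (sym k′≡k) (ℕ.≤-<-trans (ℕ.m∸n≤m c c₀) c<k)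
          effective : ∀ {c} → c₀ ℕ.< c → 0ℤ ≤ rank (position c) → NonEmpty∣ + (c ℕ.∸ c₀) ·ᵈ (⟨ u ⟩ -ᵈ ⟨ v ⟩) +ᵈ ⟨ w ⟩ ∣
          effective {c} c₀<c p = nonEmpty-resp-∼ graph
            (≗⇒∼ (λ x → trans
                (cong (λ z → D x + (1ℤ - deg D + z) * ⟨ u ⟩ x + - z * ⟨ v ⟩ x) (cong +_ (sym (ℕ.m∸n+n≡m (ℕ.<⇒≤ c₀<c)))))
                (split (D x) (1ℤ - deg D) (+ (c ℕ.∸ c₀)) (+ c₀) (⟨ u ⟩ x) (⟨ v ⟩ x)))
              ◅◅ +ᵈ-cong-∼ graph (+ (c ℕ.∸ c₀) ·ᵈ (⟨ u ⟩ -ᵈ ⟨ v ⟩)) (proj₂ point)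
              ◅◅ ≗⇒∼ (λ x → ℤ.+-comm (⟨ w ⟩ x) (+ (c ℕ.∸ c₀) * (⟨ u ⟩ x - ⟨ v ⟩ x))))
            (0≤rank⇒nonEmpty graph p)
            where
            split : ∀ d e m c u v → d + (e + (m + c)) * u + - (m + c) * v ≡ d + (e + c) * u + - c * v + m * (u - v)
            split = solve-∀

        general : (Σ (ℤ → ℤ) λ τ → Σ (ℤ → ℤ) λ σ → ((∀ a i → δ (τ i ℤ.≟ a) ≡ mixedDifference (twistRank D) a i) ×
                    (∀ a → τ (σ a) ≡ a) × (∀ i → σ (τ i) ≡ i))) →
                  ∃[ τ ] (IsTransmissionPermutation M D τ × ∃[ N ] (IsInv k τ N × + N ≤ genus))
        general (τ , σ , transmits , τσ , στ) = τ⁻ , (bijective , λ a b → trans (transmits a (- b)) (sym (Δ-twist⁻ D a b))) ,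
            proj₁ inversions , proj₂ inversions , subst (+ proj₁ inversions ≤_) (sym g≡2) (+≤+ (inversions≤2 no-three))
          where
          -- The lattice permutation is indexed by the coefficient of v, the transmission
          -- permutation by its negative.
          τ⁻ : ℤ → ℤ
          τ⁻ b = τ (- b)
          bijective : Bijective _≡_ _≡_ τ⁻
          bijective = (λ {b} {b′} eq → ℤ.neg-injective (trans (sym (στ (- b))) (trans (cong σ eq) (στ (- b′))))) ,
            λ a → - σ a , λ { refl → trans (cong τ (ℤ.neg-involutive (σ a))) (τσ a) }
          instance
            k≢0 : NonZero k
            k≢0 = ℕ.>-nonZero (proj₁ torsion)
          open Transmission L k (twistRank-periodic (proj₁ (proj₂ torsion)) D) τ⁻ (λ a b → transmits a (- b))
            using (inversions; inversions≤2)

mainTheorem5 : (M : TwiceMarkedGraph) (k : ℕ) →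
    ChipFiring.Bridgeless (TwiceMarkedGraph.graph M) →
    ChipFiring.genus (TwiceMarkedGraph.graph M) ≡ + 2 →
    RigidlyMarked M →
    HasTorsionOrder M k →
    HasGeneralTransmission M k ⇔ ChipFiring.NonRecurrent (TwiceMarkedGraph.graph M) ([u-v] M)
mainTheorem5 M k _ g≡2 rigid torsion =
  mk⇔ (transmission⇒nonRecurrent M g≡2 rigid torsion) (nonRecurrent⇒transmission M g≡2 rigid torsion)
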